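{- $$c_2=\frac{\sqrt{33}+3}{16}\sqrt{30+2\sqrt{33}}.$$
   Context: Let $\mathcal{C}$ be the unit circle in $\mathbb{R}^2$ centered at the origin, let $R=(1,0)$, and let $d(\cdot,\cdot)$ denote Euclidean distance. For $k\in\mathbb{N}$ define $$c_k=\sup_{(T_1,\dots,T_k)\in\mathcal{C}^k}\ \min_\sigma\Big(d(R,T_{\sigma(1)})+\sum_{i=2}^k d(T_{\sigma(i-1)},T_{\sigma(i)})\Big),$$ the minimum being over all permutations $\sigma$ of $\{1,\dots,k\}$. In particular $$c_2=\sup_{(T_1,T_2)\in\mathcal{C}^2}\min\big(d(R,T_1)+d(T_1,T_2),\ d(R,T_2)+d(T_2,T_1)\big).$$ -}

module Defs where

open import Data.Bool.Base using (T; if_then_else_; true; false)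
open import Data.Fin.Base using (Fin; zero; suc; punchIn)
open import Data.Fin.Permutation
  using (Permutation′; _⟨$⟩ʳ_; _≈_; id; insert; remove; insert-punchIn; punchIn-permute)
open import Data.Integer.Base as ℤ using (ℤ; +_)
import Data.Integer.DivMod as ℤ
import Data.Integer.Properties as ℤ
open import Data.List.Base as List using (allFin)
open import Data.List.NonEmpty.Base as List⁺ using (List⁺; _∷_)
open import Data.List.Membership.Propositional using (_∈_)
open import Data.List.Membership.Propositional.Properties
  using (∈-map⁺; ∈-concat⁺′; ∈-allFin)
open import Data.List.Relation.Unary.Any using (here; there)
open import Data.Nat.Base as ℕ using (ℕ; zero; suc; NonZero)
import Data.Nat.Properties as ℕ
open import Data.Product.Base using (Σ; ∃; _×_; _,_; proj₁; proj₂)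
open import Data.Rational.Base as ℚ using (ℚ; 0ℚ; 1ℚ; ½; ∣_∣)
import Data.Rational.Properties as ℚ
open import Data.Rational.Unnormalised.Base as ℚᵘ using (mkℚᵘ)
import Data.Rational.Unnormalised.Properties as ℚᵘ
open import Data.Rational.Solver using (module +-*-Solver)
open import Data.Sum.Base using (inj₁; inj₂)
open import Data.Vec.Functional using (Vector; head; tail)
open import Relation.Binary.PropositionalEquality
open import Relation.Nullary using (yes; no; contradiction)

-- The reals are the setoid (ℝ, _≃_) of Cauchy sequences of rationals modulo
-- null sequences.  As representatives are Cauchy, x ≤ y (termwise x n ≤ y n + ε
-- eventually, for every ε) is the negation of y < x.

CauchySeq : (ℕ → ℚ) → Set
CauchySeq x = ∀ ε → 0ℚ ℚ.< ε →
  ∃ λ N → ∀ m n → N ℕ.≤ m → N ℕ.≤ n → ∣ x m ℚ.- x n ∣ ℚ.≤ ε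

record ℝ : Set where
  no-eta-equality
  constructor mkℝ
  field
    approx : ℕ → ℚ
    cauchy : CauchySeq approx

open ℝ public

infix 4 _≃_ _≤_

record _≃_ (x y : ℝ) : Set where
  constructor mk≃
  field
    close : ∀ ε → 0ℚ ℚ.< ε →
      ∃ λ N → ∀ n → N ℕ.≤ n → ∣ approx x n ℚ.- approx y n ∣ ℚ.≤ ε

record _≤_ (x y : ℝ) : Set where
  constructor mk≤
  field
    below : ∀ ε → 0ℚ ℚ.< ε →
      ∃ λ N → ∀ n → N ℕ.≤ n → approx x n ℚ.≤ approx y n ℚ.+ ε

-- ⌊ √ n ⌋

isqrt : ℕ → ℕ
isqrt zero    = 0
isqrt (suc n) =
  if suc (isqrt n) ℕ.* suc (isqrt n) ℕ.≤ᵇ suc n then suc (isqrt n) else isqrt n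

-- ⌊ N √ q ⌋ / N for q ≥ 0, and 0 for q ≤ 0

sqrtℚ : (N : ℕ) .{{_ : NonZero N}} → ℚ → ℚ
sqrtℚ N q = + isqrt ℤ.∣ ℚ.floor ((0ℚ ℚ.⊔ q) ℚ.* (+ (N ℕ.* N) ℚ./ 1)) ∣ ℚ./ N

private
  open +-*-Solver using (solve; _:=_; _:+_; _:*_; :-_; _:-_; con)

  0<½ : 0ℚ ℚ.< ½
  0<½ = ℚ.positive⁻¹ ½

  half-pos : ∀ ε → 0ℚ ℚ.< ε → 0ℚ ℚ.< ½ ℚ.* ε
  half-pos ε 0<ε = ℚ.positive⁻¹ _ {{ℚ.pos*pos⇒pos ½ ε {{ℚ.positive 0<ε}}}}

  halves : ∀ ε → ½ ℚ.* ε ℚ.+ ½ ℚ.* ε ≡ ε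
  halves = solve 1 (λ e → con ½ :* e :+ con ½ :* e := e) refl

  add-sub : ∀ p q → q ℚ.+ (p ℚ.- q) ≡ p
  add-sub = solve 2 (λ p q → q :+ (p :- q) := p) refl

  sub-add : ∀ q ε → q ℚ.+ ε ℚ.- q ≡ ε
  sub-add = solve 2 (λ q e → q :+ e :- q := e) refl

  ∣-∣-sym : ∀ p q → ∣ p ℚ.- q ∣ ≡ ∣ q ℚ.- p ∣
  ∣-∣-sym p q = trans (sym (ℚ.∣-p∣≡∣p∣ (p ℚ.- q)))
    (cong ∣_∣ (solve 2 (λ p q → :- (p :- q) := q :- p) refl p q))

  p≤∣p∣ : ∀ p → p ℚ.≤ ∣ p ∣
  p≤∣p∣ p with ℚ.≤-total 0ℚ p
  ... | inj₁ 0≤p = ℚ.≤-reflexive (sym (ℚ.0≤p⇒∣p∣≡p 0≤p))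
  ... | inj₂ p≤0 = ℚ.≤-trans p≤0 (ℚ.0≤∣p∣ p)

  dist⇒≤ : ∀ p q ε → ∣ p ℚ.- q ∣ ℚ.≤ ε → p ℚ.≤ q ℚ.+ ε
  dist⇒≤ p q ε h = subst (ℚ._≤ q ℚ.+ ε) (add-sub p q)
    (ℚ.+-monoʳ-≤ q (ℚ.≤-trans (p≤∣p∣ (p ℚ.- q)) h))

  dist⇒≥ : ∀ p q ε → ∣ p ℚ.- q ∣ ℚ.≤ ε → q ℚ.≤ p ℚ.+ ε
  dist⇒≥ p q ε h = dist⇒≤ q p ε (subst (ℚ._≤ ε) (∣-∣-sym p q) h)

  ≤⇒sub≤ : ∀ p q ε → p ℚ.≤ q ℚ.+ ε → p ℚ.- q ℚ.≤ ε
  ≤⇒sub≤ p q ε h = subst (p ℚ.- q ℚ.≤_) (sub-add q ε) (ℚ.+-monoˡ-≤ (ℚ.- q) h)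

  ≤⇒dist : ∀ p q ε → p ℚ.≤ q ℚ.+ ε → q ℚ.≤ p ℚ.+ ε → ∣ p ℚ.- q ∣ ℚ.≤ ε
  ≤⇒dist p q ε h k with ℚ.∣p∣≡p∨∣p∣≡-p (p ℚ.- q)
  ... | inj₁ e = subst (ℚ._≤ ε) (sym e) (≤⇒sub≤ p q ε h)
  ... | inj₂ e = subst (ℚ._≤ ε)
    (sym (trans e (solve 2 (λ p q → :- (p :- q) := q :- p) refl p q))) (≤⇒sub≤ q p ε k)

  bounded : ∀ x → ∃ λ B → 0ℚ ℚ.< B × ∃ λ N → ∀ n → N ℕ.≤ n → ∣ approx x n ∣ ℚ.≤ B
  bounded x with cauchy x 1ℚ (ℚ.positive⁻¹ 1ℚ)
  ... | N , h = B , 0<B , N , bound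
    where
    a B : ℚ
    a = approx x N
    B = ∣ a ∣ ℚ.+ 1ℚ
    0<B : 0ℚ ℚ.< B
    0<B = ℚ.<-≤-trans (ℚ.positive⁻¹ 1ℚ)
      (subst (ℚ._≤ B) (ℚ.+-identityˡ 1ℚ) (ℚ.+-monoˡ-≤ 1ℚ (ℚ.0≤∣p∣ a)))
    bound : ∀ n → N ℕ.≤ n → ∣ approx x n ∣ ℚ.≤ B
    bound n N≤n = begin
      ∣ approx x n ∣                   ≡⟨ cong ∣_∣ (sym (add-sub _ a)) ⟩
      ∣ a ℚ.+ (approx x n ℚ.- a) ∣     ≤⟨ ℚ.∣p+q∣≤∣p∣+∣q∣ a _ ⟩
      ∣ a ∣ ℚ.+ ∣ approx x n ℚ.- a ∣   ≤⟨ ℚ.+-monoʳ-≤ ∣ a ∣ (h n N N≤n ℕ.≤-refl) ⟩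
      B                                ∎
      where open ℚ.≤-Reasoning

  mul-mono : ∀ {p p′ q q′} → 0ℚ ℚ.≤ q → 0ℚ ℚ.≤ p′ →
             p ℚ.≤ p′ → q ℚ.≤ q′ → p ℚ.* q ℚ.≤ p′ ℚ.* q′
  mul-mono {p} {p′} {q} {q′} 0≤q 0≤p′ h k = ℚ.≤-trans
    (ℚ.*-monoʳ-≤-nonNeg q {{ℚ.nonNegative 0≤q}} h)
    (ℚ.*-monoˡ-≤-nonNeg p′ {{ℚ.nonNegative 0≤p′}} k)

  ≤-from-squares : ∀ {p q} → 0ℚ ℚ.≤ q → p ℚ.* p ℚ.≤ q ℚ.* q → p ℚ.≤ q
  ≤-from-squares {p} {q} 0≤q h with ℚ._≤?_ p q
  ... | yes p≤q = p≤q
  ... | no  p≰q = contradiction (ℚ.<-≤-trans q²<p² h) (ℚ.<-irrefl refl)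
    where
    q<p : q ℚ.< p
    q<p = ℚ.≰⇒> p≰q
    q²<p² : q ℚ.* q ℚ.< p ℚ.* p
    q²<p² = ℚ.≤-<-trans
      (ℚ.*-monoˡ-≤-nonNeg q {{ℚ.nonNegative 0≤q}} (ℚ.<⇒≤ q<p))
      (ℚ.*-monoˡ-<-pos p {{ℚ.positive (ℚ.≤-<-trans 0≤q q<p)}} q<p)

abstract
  isqrt-lower : ∀ n → isqrt n ℕ.* isqrt n ℕ.≤ n
  isqrt-lower zero = ℕ.z≤n
  isqrt-lower (suc n)
    with suc (isqrt n) ℕ.* suc (isqrt n) ℕ.≤ᵇ suc n in eq
  ... | true  = ℕ.≤ᵇ⇒≤ _ _ (subst T (sym eq) _)
  ... | false = ℕ.m≤n⇒m≤1+n (isqrt-lower n)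

  isqrt-upper : ∀ n → n ℕ.< suc (isqrt n) ℕ.* suc (isqrt n)
  isqrt-upper zero = ℕ.s≤s ℕ.z≤n
  isqrt-upper (suc n)
    with suc (isqrt n) ℕ.* suc (isqrt n) ℕ.≤ᵇ suc n in eq
  ... | true  = ℕ.<-≤-trans (ℕ.s≤s (isqrt-upper n))
                  (ℕ.*-mono-< (ℕ.n<1+n (suc (isqrt n))) (ℕ.n<1+n (suc (isqrt n))))
  ... | false = ℕ.≰⇒> λ le → subst T eq (ℕ.≤⇒≤ᵇ le)

  fromℕ/-* : ∀ s N .{{_ : NonZero N}} → (+ s ℚ./ N) ℚ.* (+ N ℚ./ 1) ≡ + s ℚ./ 1
  fromℕ/-* s N@(suc N-1) = ℚ.toℚᵘ-injective (begin
    ℚ.toℚᵘ ((+ s ℚ./ N) ℚ.* (+ N ℚ./ 1))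
      ≈⟨ ℚ.toℚᵘ-homo-* (+ s ℚ./ N) (+ N ℚ./ 1) ⟩
    ℚ.toℚᵘ (+ s ℚ./ N) ℚᵘ.* ℚ.toℚᵘ (+ N ℚ./ 1)
      ≈⟨ ℚᵘ.*-cong (ℚ.toℚᵘ-fromℚᵘ (mkℚᵘ (+ s) N-1)) (ℚ.toℚᵘ-fromℚᵘ (mkℚᵘ (+ N) 0)) ⟩
    mkℚᵘ (+ s) N-1 ℚᵘ.* mkℚᵘ (+ N) 0
      ≈⟨ ℚᵘ.*≡* (trans (ℤ.*-identityʳ _) (cong (+ s ℤ.*_) (cong +_ (sym (ℕ.*-identityʳ N))))) ⟩
    mkℚᵘ (+ s) 0
      ≈⟨ ℚᵘ.≃-sym (ℚ.toℚᵘ-fromℚᵘ (mkℚᵘ (+ s) 0)) ⟩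
    ℚ.toℚᵘ (+ s ℚ./ 1) ∎)
    where open ℚᵘ.≃-Reasoning

  ι-* : ∀ m n → (+ m ℚ./ 1) ℚ.* (+ n ℚ./ 1) ≡ + (m ℕ.* n) ℚ./ 1
  ι-* m n = ℚ.toℚᵘ-injective (begin
    ℚ.toℚᵘ ((+ m ℚ./ 1) ℚ.* (+ n ℚ./ 1))
      ≈⟨ ℚ.toℚᵘ-homo-* (+ m ℚ./ 1) (+ n ℚ./ 1) ⟩
    ℚ.toℚᵘ (+ m ℚ./ 1) ℚᵘ.* ℚ.toℚᵘ (+ n ℚ./ 1)
      ≈⟨ ℚᵘ.*-cong (ℚ.toℚᵘ-fromℚᵘ (mkℚᵘ (+ m) 0)) (ℚ.toℚᵘ-fromℚᵘ (mkℚᵘ (+ n) 0)) ⟩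
    mkℚᵘ (+ m) 0 ℚᵘ.* mkℚᵘ (+ n) 0
      ≈⟨ ℚᵘ.*≡* (cong (ℤ._* + 1) (sym (ℤ.pos-* m n))) ⟩
    mkℚᵘ (+ (m ℕ.* n)) 0
      ≈⟨ ℚᵘ.≃-sym (ℚ.toℚᵘ-fromℚᵘ (mkℚᵘ (+ (m ℕ.* n)) 0)) ⟩
    ℚ.toℚᵘ (+ (m ℕ.* n) ℚ./ 1) ∎)
    where open ℚᵘ.≃-Reasoning

  ι-suc : ∀ n → (+ n ℚ./ 1) ℚ.+ 1ℚ ≡ + suc n ℚ./ 1
  ι-suc n = ℚ.toℚᵘ-injective (begin
    ℚ.toℚᵘ ((+ n ℚ./ 1) ℚ.+ 1ℚ)
      ≈⟨ ℚ.toℚᵘ-homo-+ (+ n ℚ./ 1) 1ℚ ⟩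
    ℚ.toℚᵘ (+ n ℚ./ 1) ℚᵘ.+ mkℚᵘ (+ 1) 0
      ≈⟨ ℚᵘ.+-congˡ (mkℚᵘ (+ 1) 0) (ℚ.toℚᵘ-fromℚᵘ (mkℚᵘ (+ n) 0)) ⟩
    mkℚᵘ (+ n) 0 ℚᵘ.+ mkℚᵘ (+ 1) 0
      ≈⟨ ℚᵘ.*≡* (cong (ℤ._* + 1) (trans (cong (ℤ._+ + 1) (ℤ.*-identityʳ (+ n))) (ℤ.+-comm (+ n) (+ 1)))) ⟩
    mkℚᵘ (+ suc n) 0
      ≈⟨ ℚᵘ.≃-sym (ℚ.toℚᵘ-fromℚᵘ (mkℚᵘ (+ suc n) 0)) ⟩
    ℚ.toℚᵘ (+ suc n ℚ./ 1) ∎)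
    where open ℚᵘ.≃-Reasoning

  /1≤ : ∀ i q → i ℤ.* ℚ.↧ q ℤ.≤ ℚ.↥ q → i ℚ./ 1 ℚ.≤ q
  /1≤ i q@record{} h = ℚ.toℚᵘ-cancel-≤ (ℚᵘ.≤-respˡ-≃ (ℚᵘ.≃-sym (ℚ.toℚᵘ-fromℚᵘ (mkℚᵘ i 0)))
    (ℚᵘ.*≤* (subst (i ℤ.* ℚ.↧ q ℤ.≤_) (sym (ℤ.*-identityʳ (ℚ.↥ q))) h)))

  ≤/1 : ∀ i q → ℚ.↥ q ℤ.≤ i ℤ.* ℚ.↧ q → q ℚ.≤ i ℚ./ 1
  ≤/1 i q@record{} h = ℚ.toℚᵘ-cancel-≤ (ℚᵘ.≤-respʳ-≃ (ℚᵘ.≃-sym (ℚ.toℚᵘ-fromℚᵘ (mkℚᵘ i 0)))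
    (ℚᵘ.*≤* (subst (ℤ._≤ i ℤ.* ℚ.↧ q) (sym (ℤ.*-identityʳ (ℚ.↥ q))) h)))

  /-mono : ∀ i j d .{{_ : NonZero d}} → i ℤ.≤ j → i ℚ./ d ℚ.≤ j ℚ./ d
  /-mono i j d@(suc d-1) h = ℚ.toℚᵘ-cancel-≤
    (ℚᵘ.≤-respˡ-≃ (ℚᵘ.≃-sym (ℚ.toℚᵘ-fromℚᵘ (mkℚᵘ i d-1)))
    (ℚᵘ.≤-respʳ-≃ (ℚᵘ.≃-sym (ℚ.toℚᵘ-fromℚᵘ (mkℚᵘ j d-1)))
    (ℚᵘ.*≤* (ℤ.*-monoʳ-≤-nonNeg (+ d) h))))

  0≤/ : ∀ n d .{{_ : NonZero d}} → 0ℚ ℚ.≤ + n ℚ./ d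
  0≤/ n d = subst (ℚ._≤ + n ℚ./ d) (ℚ.0/n≡0 d) (/-mono (+ 0) (+ n) d (ℤ.+≤+ ℕ.z≤n))

  0≤floor : ∀ X → 0ℚ ℚ.≤ X → + 0 ℤ.≤ ℚ.floor X
  0≤floor X@record{} 0≤X = ℤ.0≤n⇒0≤n/d (ℚ.↥ X) (ℚ.↧ X)
    (subst₂ ℤ._≤_ (ℤ.*-zeroˡ (ℚ.↧ X)) (ℤ.*-identityʳ (ℚ.↥ X)) (ℚ.drop-*≤* 0≤X)) (ℤ.+≤+ ℕ.z≤n)

  floor-lower : ∀ X → ℚ.floor X ℤ.* ℚ.↧ X ℤ.≤ ℚ.↥ X
  floor-lower X@record{} = ℤ.[n/d]*d≤n (ℚ.↥ X) (ℚ.↧ X)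

  floor-upper : ∀ X → ℚ.↥ X ℤ.≤ ℤ.suc (ℚ.floor X) ℤ.* ℚ.↧ X
  floor-upper X@record{} = subst (λ f → ℚ.↥ X ℤ.≤ ℤ.suc f ℤ.* ℚ.↧ X)
    (sym (ℤ.div-pos-is-/ℕ (ℚ.↥ X) (ℚ.↧ₙ X)))
    (ℤ.<⇒≤ (ℤ.n<s[n/ℕd]*d (ℚ.↥ X) (ℚ.↧ₙ X)))

  ∣floor∣-lower : ∀ X → 0ℚ ℚ.≤ X → + ℤ.∣ ℚ.floor X ∣ ℚ./ 1 ℚ.≤ X
  ∣floor∣-lower X 0≤X = /1≤ (+ ℤ.∣ ℚ.floor X ∣) X (subst (λ f → f ℤ.* ℚ.↧ X ℤ.≤ ℚ.↥ X)
    (sym (ℤ.0≤i⇒+∣i∣≡i (0≤floor X 0≤X))) (floor-lower X))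

  ∣floor∣-upper : ∀ X → 0ℚ ℚ.≤ X → X ℚ.≤ + suc ℤ.∣ ℚ.floor X ∣ ℚ./ 1
  ∣floor∣-upper X 0≤X = ≤/1 (+ suc ℤ.∣ ℚ.floor X ∣) X (subst (λ f → ℚ.↥ X ℤ.≤ ℤ.suc f ℤ.* ℚ.↧ X)
    (sym (ℤ.0≤i⇒+∣i∣≡i (0≤floor X 0≤X))) (floor-upper X))

  module _ (N : ℕ) .{{_ : NonZero N}} (q : ℚ) where
    private
      Q ν ν² X r δ : ℚ
      n : ℕ
      Q = 0ℚ ℚ.⊔ q
      ν = + N ℚ./ 1
      ν² = + (N ℕ.* N) ℚ./ 1
      X = Q ℚ.* ν²
      n = ℤ.∣ ℚ.floor X ∣
      r = sqrtℚ N q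
      δ = + 1 ℚ./ N
      0<ν² : ℚ.Positive ν²
      0<ν² = ℚ.normalize-pos (N ℕ.* N) 1 {{_}} {{ℕ.m*n≢0 N N}}
      0≤X : 0ℚ ℚ.≤ X
      0≤X = subst (ℚ._≤ X) (ℚ.*-zeroˡ ν²)
        (ℚ.*-monoʳ-≤-nonNeg ν² {{ℚ.pos⇒nonNeg ν² {{0<ν²}}}} (ℚ.p≤p⊔q 0ℚ q))
      square : ∀ a → (a ℚ.* a) ℚ.* ν² ≡ (a ℚ.* ν) ℚ.* (a ℚ.* ν)
      square a = trans (cong ((a ℚ.* a) ℚ.*_) (sym (ι-* N N)))
        (solve 2 (λ a v → (a :* a) :* (v :* v) := (a :* v) :* (a :* v)) refl a ν)
      square/ : ∀ s → ((+ s ℚ./ N) ℚ.* (+ s ℚ./ N)) ℚ.* ν² ≡ + (s ℕ.* s) ℚ./ 1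
      square/ s = trans (square (+ s ℚ./ N))
        (trans (cong₂ ℚ._*_ (fromℕ/-* s N) (fromℕ/-* s N)) (ι-* s s))
      suc/ : ∀ s → ((+ s ℚ./ N) ℚ.+ δ) ℚ.* ν ≡ + suc s ℚ./ 1
      suc/ s = trans (ℚ.*-distribʳ-+ ν (+ s ℚ./ N) δ)
        (trans (cong₂ ℚ._+_ (fromℕ/-* s N) (fromℕ/-* 1 N)) (ι-suc s))

    sqrtℚ-nonNeg : 0ℚ ℚ.≤ sqrtℚ N q
    sqrtℚ-nonNeg = 0≤/ (isqrt n) N

    sqrtℚ-lower : sqrtℚ N q ℚ.* sqrtℚ N q ℚ.≤ 0ℚ ℚ.⊔ q
    sqrtℚ-lower = ℚ.*-cancelʳ-≤-pos ν² {{0<ν²}} (subst (ℚ._≤ X) (sym (square/ (isqrt n)))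
      (ℚ.≤-trans (/-mono (+ (isqrt n ℕ.* isqrt n)) (+ n) 1 (ℤ.+≤+ (isqrt-lower n))) (∣floor∣-lower X 0≤X)))

    sqrtℚ-upper : 0ℚ ℚ.⊔ q ℚ.≤
      (sqrtℚ N q ℚ.+ (+ 1 ℚ./ N)) ℚ.* (sqrtℚ N q ℚ.+ (+ 1 ℚ./ N))
    sqrtℚ-upper = ℚ.*-cancelʳ-≤-pos ν² {{0<ν²}} (begin
      X                                     ≤⟨ ∣floor∣-upper X 0≤X ⟩
      + suc n ℚ./ 1                         ≤⟨ /-mono (+ suc n) (+ (suc s ℕ.* suc s)) 1 (ℤ.+≤+ (isqrt-upper n)) ⟩
      + (suc s ℕ.* suc s) ℚ./ 1             ≡⟨ sym (ι-* (suc s) (suc s)) ⟩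
      (+ suc s ℚ./ 1) ℚ.* (+ suc s ℚ./ 1)   ≡⟨ cong₂ ℚ._*_ (sym (suc/ s)) (sym (suc/ s)) ⟩
      ((r ℚ.+ δ) ℚ.* ν) ℚ.* ((r ℚ.+ δ) ℚ.* ν)  ≡⟨ sym (square (r ℚ.+ δ)) ⟩
      ((r ℚ.+ δ) ℚ.* (r ℚ.+ δ)) ℚ.* ν²      ∎)
      where
      open ℚ.≤-Reasoning
      s : ℕ
      s = isqrt n

  1/suc≤ : ∀ η → 0ℚ ℚ.< η → ∀ n → ℚ.↧ₙ η ℕ.≤ n → + 1 ℚ./ suc n ℚ.≤ η
  1/suc≤ η@(ℚ.mkℚ (+ suc p) d _) 0<η n h = ℚ.toℚᵘ-cancel-≤
    (ℚᵘ.≤-respˡ-≃ (ℚᵘ.≃-sym (ℚ.toℚᵘ-fromℚᵘ (mkℚᵘ (+ 1) n)))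
    (ℚᵘ.*≤* (ℤ.+≤+ (begin
      suc d ℕ.+ 0          ≡⟨ ℕ.+-identityʳ (suc d) ⟩
      suc d                ≤⟨ h ⟩
      n                    ≤⟨ ℕ.n≤1+n n ⟩
      suc n                ≤⟨ ℕ.m≤m+n (suc n) (p ℕ.* suc n) ⟩
      suc p ℕ.* suc n      ∎))))
    where open ℕ.≤-Reasoning
  1/suc≤ (ℚ.mkℚ (+ zero) d _) (ℚ.*<* (ℤ.+<+ ())) n h
  1/suc≤ (ℚ.mkℚ ℤ.-[1+ p ] d _) (ℚ.*<* ()) n h

  const-cauchy : ∀ q → CauchySeq (λ _ → q)
  const-cauchy q ε 0<ε = 0 , λ _ _ _ _ →
    subst (λ p → ∣ p ∣ ℚ.≤ ε) (sym (ℚ.+-inverseʳ q)) (ℚ.<⇒≤ 0<ε)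

  +-cauchy : ∀ x y → CauchySeq (λ n → approx x n ℚ.+ approx y n)
  +-cauchy x y ε 0<ε with cauchy x (½ ℚ.* ε) (half-pos ε 0<ε) | cauchy y (½ ℚ.* ε) (half-pos ε 0<ε)
  ... | M , h | N , k = M ℕ.⊔ N , λ m n m≥ n≥ → subst₂ ℚ._≤_
    (cong ∣_∣ (regroup (approx x m) (approx x n) (approx y m) (approx y n))) (halves ε)
    (ℚ.≤-trans (ℚ.∣p+q∣≤∣p∣+∣q∣ (approx x m ℚ.- approx x n) (approx y m ℚ.- approx y n))
      (ℚ.+-mono-≤ (h m n (ℕ.m⊔n≤o⇒m≤o M N m≥) (ℕ.m⊔n≤o⇒m≤o M N n≥))
                  (k m n (ℕ.m⊔n≤o⇒n≤o M N m≥) (ℕ.m⊔n≤o⇒n≤o M N n≥))))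
    where
    regroup : ∀ a a′ b b′ → (a ℚ.- a′) ℚ.+ (b ℚ.- b′) ≡ (a ℚ.+ b) ℚ.- (a′ ℚ.+ b′)
    regroup = solve 4 (λ a a′ b b′ → (a :- a′) :+ (b :- b′) := (a :+ b) :- (a′ :+ b′)) refl

  neg-cauchy : ∀ x → CauchySeq (λ n → ℚ.- approx x n)
  neg-cauchy x ε 0<ε with cauchy x ε 0<ε
  ... | N , h = N , λ m n m≥ n≥ → subst (ℚ._≤ ε)
    (trans (∣-∣-sym (approx x m) (approx x n)) (cong ∣_∣ (swap (approx x m) (approx x n)))) (h m n m≥ n≥)
    where
    swap : ∀ a b → b ℚ.- a ≡ (ℚ.- a) ℚ.- (ℚ.- b)
    swap = solve 2 (λ a b → b :- a := (:- a) :- (:- b)) refl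

  split-budget : ∀ A B ε → 0ℚ ℚ.< A → 0ℚ ℚ.< B → 0ℚ ℚ.< ε →
                 ∃ λ δ → 0ℚ ℚ.< δ × A ℚ.* δ ℚ.+ δ ℚ.* B ≡ ε
  split-budget A B ε 0<A 0<B 0<ε = δ , 0<δ , total
    where
    K : ℚ
    K = A ℚ.+ B
    0<K : ℚ.Positive K
    0<K = ℚ.positive (ℚ.+-mono-< 0<A 0<B)
    K⁻¹ : ℚ
    K⁻¹ = ℚ.1/_ K {{ℚ.pos⇒nonZero K {{0<K}}}}
    δ : ℚ
    δ = ε ℚ.* K⁻¹
    0<δ : 0ℚ ℚ.< δ
    0<δ = ℚ.positive⁻¹ δ
      {{ℚ.pos*pos⇒pos ε {{ℚ.positive 0<ε}} K⁻¹ {{ℚ.1/pos⇒pos K {{0<K}}}}}}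
    total : A ℚ.* δ ℚ.+ δ ℚ.* B ≡ ε
    total = begin
      A ℚ.* δ ℚ.+ δ ℚ.* B    ≡⟨ cong (ℚ._+ δ ℚ.* B) (ℚ.*-comm A δ) ⟩
      δ ℚ.* A ℚ.+ δ ℚ.* B    ≡⟨ sym (ℚ.*-distribˡ-+ δ A B) ⟩
      δ ℚ.* K                ≡⟨ ℚ.*-assoc ε K⁻¹ K ⟩
      ε ℚ.* (K⁻¹ ℚ.* K)      ≡⟨ cong (ε ℚ.*_) (ℚ.*-inverseˡ K {{ℚ.pos⇒nonZero K {{0<K}}}}) ⟩
      ε ℚ.* 1ℚ               ≡⟨ ℚ.*-identityʳ ε ⟩
      ε                      ∎
      where open ≡-Reasoning

  mul-regroup : ∀ a a′ b b′ → a ℚ.* (b ℚ.- b′) ℚ.+ (a ℚ.- a′) ℚ.* b′ ≡ a ℚ.* b ℚ.- a′ ℚ.* b′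
  mul-regroup = solve 4 (λ a a′ b b′ → a :* (b :- b′) :+ (a :- a′) :* b′ := a :* b :- a′ :* b′) refl

  mul-close : ∀ A B δ a a′ b b′ → 0ℚ ℚ.< A → 0ℚ ℚ.< δ →
    ∣ a ∣ ℚ.≤ A → ∣ b′ ∣ ℚ.≤ B → ∣ a ℚ.- a′ ∣ ℚ.≤ δ → ∣ b ℚ.- b′ ∣ ℚ.≤ δ →
    ∣ a ℚ.* b ℚ.- a′ ℚ.* b′ ∣ ℚ.≤ A ℚ.* δ ℚ.+ δ ℚ.* B
  mul-close A B δ a a′ b b′ 0<A 0<δ p q r s = begin
    ∣ a ℚ.* b ℚ.- a′ ℚ.* b′ ∣
      ≡⟨ cong ∣_∣ (sym (mul-regroup a a′ b b′)) ⟩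
    ∣ a ℚ.* (b ℚ.- b′) ℚ.+ (a ℚ.- a′) ℚ.* b′ ∣
      ≤⟨ ℚ.∣p+q∣≤∣p∣+∣q∣ (a ℚ.* (b ℚ.- b′)) ((a ℚ.- a′) ℚ.* b′) ⟩
    ∣ a ℚ.* (b ℚ.- b′) ∣ ℚ.+ ∣ (a ℚ.- a′) ℚ.* b′ ∣
      ≡⟨ cong₂ ℚ._+_ (ℚ.∣p*q∣≡∣p∣*∣q∣ a (b ℚ.- b′)) (ℚ.∣p*q∣≡∣p∣*∣q∣ (a ℚ.- a′) b′) ⟩
    ∣ a ∣ ℚ.* ∣ b ℚ.- b′ ∣ ℚ.+ ∣ a ℚ.- a′ ∣ ℚ.* ∣ b′ ∣
      ≤⟨ ℚ.+-mono-≤ (mul-mono (ℚ.0≤∣p∣ (b ℚ.- b′)) (ℚ.<⇒≤ 0<A) p s)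
                    (mul-mono (ℚ.0≤∣p∣ b′) (ℚ.<⇒≤ 0<δ) r q) ⟩
    A ℚ.* δ ℚ.+ δ ℚ.* B ∎
    where open ℚ.≤-Reasoning

  *-cauchy : ∀ x y → CauchySeq (λ n → approx x n ℚ.* approx y n)
  *-cauchy x y ε 0<ε =
    let A , 0<A , N₁ , ∣x∣≤A = bounded x
        B , 0<B , N₂ , ∣y∣≤B = bounded y
        δ , 0<δ , total = split-budget A B ε 0<A 0<B 0<ε
        N₃ , h = cauchy x δ 0<δ
        N₄ , k = cauchy y δ 0<δ
        L = N₁ ℕ.⊔ N₂
        M = N₃ ℕ.⊔ N₄
        ≥₁ = λ {n} (n≥ : L ℕ.⊔ M ℕ.≤ n) → ℕ.m⊔n≤o⇒m≤o N₁ N₂ (ℕ.m⊔n≤o⇒m≤o L M n≥)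
        ≥₂ = λ {n} (n≥ : L ℕ.⊔ M ℕ.≤ n) → ℕ.m⊔n≤o⇒n≤o N₁ N₂ (ℕ.m⊔n≤o⇒m≤o L M n≥)
        ≥₃ = λ {n} (n≥ : L ℕ.⊔ M ℕ.≤ n) → ℕ.m⊔n≤o⇒m≤o N₃ N₄ (ℕ.m⊔n≤o⇒n≤o L M n≥)
        ≥₄ = λ {n} (n≥ : L ℕ.⊔ M ℕ.≤ n) → ℕ.m⊔n≤o⇒n≤o N₃ N₄ (ℕ.m⊔n≤o⇒n≤o L M n≥)
    in L ℕ.⊔ M , λ m n m≥ n≥ → subst (∣ approx x m ℚ.* approx y m ℚ.- approx x n ℚ.* approx y n ∣ ℚ.≤_) total
      (mul-close A B δ (approx x m) (approx x n) (approx y m) (approx y n) 0<A 0<δ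
        (∣x∣≤A m (≥₁ m≥)) (∣y∣≤B n (≥₂ n≥))
        (h m n (≥₃ m≥) (≥₃ n≥)) (k m n (≥₄ m≥) (≥₄ n≥)))

  ⊓-cauchy : ∀ x y → CauchySeq (λ n → approx x n ℚ.⊓ approx y n)
  ⊓-cauchy x y ε 0<ε with cauchy x ε 0<ε | cauchy y ε 0<ε
  ... | M , h | N , k = M ℕ.⊔ N , λ m n m≥ n≥ →
    let p = h m n (ℕ.m⊔n≤o⇒m≤o M N m≥) (ℕ.m⊔n≤o⇒m≤o M N n≥)
        q = k m n (ℕ.m⊔n≤o⇒n≤o M N m≥) (ℕ.m⊔n≤o⇒n≤o M N n≥)
    in ≤⇒dist (approx x m ℚ.⊓ approx y m) (approx x n ℚ.⊓ approx y n) ε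
         (below (approx x m) (approx x n) (approx y m) (approx y n)
           (dist⇒≤ (approx x m) (approx x n) ε p) (dist⇒≤ (approx y m) (approx y n) ε q))
         (below (approx x n) (approx x m) (approx y n) (approx y m)
           (dist⇒≥ (approx x m) (approx x n) ε p) (dist⇒≥ (approx y m) (approx y n) ε q))
    where
    below : ∀ a a′ b b′ → a ℚ.≤ a′ ℚ.+ ε → b ℚ.≤ b′ ℚ.+ ε → a ℚ.⊓ b ℚ.≤ (a′ ℚ.⊓ b′) ℚ.+ ε
    below a a′ b b′ p q = subst (a ℚ.⊓ b ℚ.≤_)
      (sym (ℚ.mono-≤-distrib-⊓ (ℚ.+-monoˡ-≤ ε) a′ b′))
      (ℚ.⊓-glb (ℚ.≤-trans (ℚ.p⊓q≤p a b) p) (ℚ.≤-trans (ℚ.p⊓q≤q a b) q))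

  0≤-+ : ∀ p q → 0ℚ ℚ.≤ p → 0ℚ ℚ.≤ q → 0ℚ ℚ.≤ p ℚ.+ q
  0≤-+ p q = ℚ.+-mono-≤ {0ℚ} {p} {0ℚ} {q}

  0≤-* : ∀ p q → 0ℚ ℚ.≤ p → 0ℚ ℚ.≤ q → 0ℚ ℚ.≤ p ℚ.* q
  0≤-* p q 0≤p 0≤q = subst (ℚ._≤ p ℚ.* q) (ℚ.*-zeroˡ q)
    (ℚ.*-monoʳ-≤-nonNeg q {{ℚ.nonNegative 0≤q}} 0≤p)

  square-expand : ∀ s η → (s ℚ.* s ℚ.+ η ℚ.* η) ℚ.+ (s ℚ.* η ℚ.+ s ℚ.* η) ≡ (s ℚ.+ η) ℚ.* (s ℚ.+ η)
  square-expand = solve 2 (λ s e → (s :* s :+ e :* e) :+ (s :* e :+ s :* e) := (s :+ e) :* (s :+ e)) refl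

  square-+ : ∀ s η → 0ℚ ℚ.≤ s → 0ℚ ℚ.≤ η → s ℚ.* s ℚ.+ η ℚ.* η ℚ.≤ (s ℚ.+ η) ℚ.* (s ℚ.+ η)
  square-+ s η 0≤s 0≤η = subst₂ ℚ._≤_ (ℚ.+-identityʳ _) (square-expand s η)
    (ℚ.+-monoʳ-≤ (s ℚ.* s ℚ.+ η ℚ.* η) (0≤-+ (s ℚ.* η) (s ℚ.* η) (0≤-* s η 0≤s 0≤η) (0≤-* s η 0≤s 0≤η)))

  root-close : ∀ a b e η r s → 0ℚ ℚ.≤ e → 0ℚ ℚ.≤ η → 0ℚ ℚ.≤ s → η ℚ.* η ≡ e →
    r ℚ.* r ℚ.≤ 0ℚ ℚ.⊔ a → 0ℚ ℚ.⊔ b ℚ.≤ s ℚ.* s → a ℚ.≤ b ℚ.+ e → r ℚ.≤ s ℚ.+ η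
  root-close a b e η r s 0≤e 0≤η 0≤s refl lo up h =
    ≤-from-squares (0≤-+ s η 0≤s 0≤η) (begin
      r ℚ.* r                    ≤⟨ lo ⟩
      0ℚ ℚ.⊔ a                   ≤⟨ ℚ.⊔-lub (0≤-+ (0ℚ ℚ.⊔ b) e (ℚ.p≤p⊔q 0ℚ b) 0≤e)
                                      (ℚ.≤-trans h (ℚ.+-monoˡ-≤ e (ℚ.p≤q⊔p 0ℚ b))) ⟩
      (0ℚ ℚ.⊔ b) ℚ.+ e           ≤⟨ ℚ.+-monoˡ-≤ e up ⟩
      s ℚ.* s ℚ.+ e              ≤⟨ square-+ s η 0≤s 0≤η ⟩
      (s ℚ.+ η) ℚ.* (s ℚ.+ η)    ∎)
    where open ℚ.≤-Reasoning

  sqrtℚ-close : ∀ η m n a b → 0ℚ ℚ.< η → ℚ.↧ₙ η ℕ.≤ n → a ℚ.≤ b ℚ.+ η ℚ.* η →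
    sqrtℚ (suc m) a ℚ.≤ sqrtℚ (suc n) b ℚ.+ (η ℚ.+ η)
  sqrtℚ-close η m n a b 0<η n≥ h = ℚ.≤-trans
    (root-close a b (η ℚ.* η) η (sqrtℚ (suc m) a) (sqrtℚ (suc n) b ℚ.+ (+ 1 ℚ./ suc n))
      (0≤-* η η 0≤η 0≤η) 0≤η
      (0≤-+ (sqrtℚ (suc n) b) (+ 1 ℚ./ suc n) (sqrtℚ-nonNeg (suc n) b) (0≤/ 1 (suc n))) refl
      (sqrtℚ-lower (suc m) a) (sqrtℚ-upper (suc n) b) h)
    (absorb (sqrtℚ (suc n) b) (+ 1 ℚ./ suc n) (1/suc≤ η 0<η n n≥))
    where
    0≤η : 0ℚ ℚ.≤ η
    0≤η = ℚ.<⇒≤ 0<η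
    absorb : ∀ r δ → δ ℚ.≤ η → (r ℚ.+ δ) ℚ.+ η ℚ.≤ r ℚ.+ (η ℚ.+ η)
    absorb r δ δ≤η = subst ((r ℚ.+ δ) ℚ.+ η ℚ.≤_) (ℚ.+-assoc r η η)
      (ℚ.+-monoˡ-≤ η (ℚ.+-monoʳ-≤ r δ≤η))

  √-cauchy : ∀ x → CauchySeq (λ n → sqrtℚ (suc n) (approx x n))
  √-cauchy x ε 0<ε =
    let η = ½ ℚ.* ε
        0<η = half-pos ε 0<ε
        0<η² = ℚ.positive⁻¹ (η ℚ.* η) {{ℚ.pos*pos⇒pos η {{ℚ.positive 0<η}} η {{ℚ.positive 0<η}}}}
        M , h = cauchy x (η ℚ.* η) 0<η²
        N = ℚ.↧ₙ η
    in M ℕ.⊔ N , λ m n m≥ n≥ →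
      let p = h m n (ℕ.m⊔n≤o⇒m≤o M N m≥) (ℕ.m⊔n≤o⇒m≤o M N n≥)
          a = approx x m
          b = approx x n
      in subst (∣ sqrtℚ (suc m) a ℚ.- sqrtℚ (suc n) b ∣ ℚ.≤_) (halves ε)
        (≤⇒dist (sqrtℚ (suc m) a) (sqrtℚ (suc n) b) (η ℚ.+ η)
          (sqrtℚ-close η m n a b 0<η (ℕ.m⊔n≤o⇒n≤o M N n≥) (dist⇒≤ a b (η ℚ.* η) p))
          (sqrtℚ-close η n m b a 0<η (ℕ.m⊔n≤o⇒n≤o M N m≥) (dist⇒≥ a b (η ℚ.* η) p)))

fromℚ : ℚ → ℝ
approx (fromℚ q) n = q
cauchy (fromℚ q) = const-cauchy q

fromℕ : ℕ → ℝ
fromℕ n = fromℚ (+ n ℚ./ 1)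

infix  8 -_
infixl 7 _*_ _/_ _⊓_
infixl 6 _+_ _-_

-_ : ℝ → ℝ
approx (- x) n = ℚ.- approx x n
cauchy (- x) = neg-cauchy x

_+_ _*_ _⊓_ : ℝ → ℝ → ℝ
approx (x + y) n = approx x n ℚ.+ approx y n
cauchy (x + y) = +-cauchy x y
approx (x * y) n = approx x n ℚ.* approx y n
cauchy (x * y) = *-cauchy x y
approx (x ⊓ y) n = approx x n ℚ.⊓ approx y n
cauchy (x ⊓ y) = ⊓-cauchy x y

_-_ : ℝ → ℝ → ℝ
x - y = x + (- y)

_/_ : ℝ → (n : ℕ) .{{_ : NonZero n}} → ℝ
x / n = x * fromℚ (+ 1 ℚ./ n)

-- Truncates: √ x ≃ 0 for x ≤ 0.

√ : ℝ → ℝ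
approx (√ x) n = sqrtℚ (suc n) (approx x n)
cauchy (√ x) = √-cauchy x

IsSupremum : {A : Set} → (A → ℝ) → ℝ → Set
IsSupremum f s = (∀ a → f a ≤ s) × (∀ u → (∀ a → f a ≤ u) → s ≤ u)

Point : Set
Point = ℝ × ℝ

d : Point → Point → ℝ
d (x₁ , y₁) (x₂ , y₂) = √ ((x₁ - x₂) * (x₁ - x₂) + (y₁ - y₂) * (y₁ - y₂))

OnUnitCircle : Point → Set
OnUnitCircle P = d P (fromℕ 0 , fromℕ 0) ≃ fromℕ 1

𝒞 : Set
𝒞 = Σ Point OnUnitCircle

R : Point
R = fromℕ 1 , fromℕ 0

permutations : ∀ k → List⁺ (Permutation′ k)
permutations zero    = List⁺.[ id ]
permutations (suc k) =
  List⁺.concatMap (λ j → List⁺.map (insert zero j) (permutations k))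
                  (zero ∷ List.map suc (allFin k))

permutations-complete : ∀ {k} (σ : Permutation′ k) →
  ∃ λ τ → τ ∈ List⁺.toList (permutations k) × τ ≈ σ
permutations-complete {zero}  σ = id , here refl , λ ()
permutations-complete {suc k} σ with permutations-complete (remove zero σ)
... | τ , τ∈ , τ≈ = insert zero j τ , ∈-concat⁺′ (∈-map⁺ (insert zero j) τ∈) j∈ , agree
  where
  j = σ ⟨$⟩ʳ zero
  row : Fin (suc k) → List⁺ (Permutation′ (suc k))
  row j = List⁺.map (insert zero j) (permutations k)
  all∈ : ∀ i → i ∈ zero List.∷ List.map suc (allFin k)
  all∈ zero    = here refl
  all∈ (suc i) = there (∈-map⁺ suc (∈-allFin i))
  j∈ : List⁺.toList (row j) ∈ List.map List⁺.toList (List.map row (zero List.∷ List.map suc (allFin k)))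
  j∈ = ∈-map⁺ List⁺.toList (∈-map⁺ row (all∈ j))
  agree : insert zero j τ ≈ σ
  agree zero    = refl
  agree (suc i) = trans (insert-punchIn zero j τ i)
    (trans (cong (punchIn j) (τ≈ i)) (sym (punchIn-permute σ zero i)))

-- d P Q₁ + d Q₁ Q₂ + … + d Qₖ₋₁ Qₖ

pathLength : ∀ {k} → Point → Vector Point k → ℝ
pathLength {zero}  P Q = fromℕ 0
pathLength {suc k} P Q = d P (head Q) + pathLength (head Q) (tail Q)

shortestPath : ∀ {k} → Vector 𝒞 k → ℝ
shortestPath {k} T = List⁺.foldr₁ _⊓_
  (List⁺.map (λ σ → pathLength R (λ i → proj₁ (T (σ ⟨$⟩ʳ i)))) (permutations k))

-- c k is a real determined up to _≃_, hence given by the predicate "v is c k".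

Is-c : ℕ → ℝ → Set
Is-c k v = IsSupremum (shortestPath {k}) v

-- With a = d(R,T₁), b = d(R,T₂), t = d(T₁,T₂), twice the shorter path is at most
-- a + b + 2t.  Let w = |T₁ + T₂|, p = √(2 + w) and q = √(2 − w).  The parallelogram
-- law w² + t² = 4 gives t = pq, and a² + b² = 4 − 2(x₁ + x₂) ≤ 4 + 2w gives
-- a + b ≤ 2p, so the shorter path is at most p(1 + q), where p² + q² = 4.  The
-- maximum of (4 − q²)(1 + q)² over q ≥ 0 is at the positive root κ = (√33 − 1)/4 of
-- 2κ² + κ = 4.  With ρ² = 4 − κ² the bound ρ(1 + κ) is attained by two points placed
-- symmetrically to the x-axis at distance ρ from R and κρ from each other.

module Submission where

open import Data.Nat.Base using (nonZero)
open import Defs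

open import Data.Fin.Base using (Fin; zero; suc)
open import Data.Integer.Base using (+_)
open import Data.Nat.Base as ℕ using (ℕ)
import Data.Nat.Properties as ℕ
open import Data.Product.Base using (∃; _×_; _,_; proj₁; proj₂)
open import Data.Rational.Base as ℚ using (ℚ; 0ℚ; 1ℚ; ½; ∣_∣)
import Data.Rational.Properties as ℚ
open import Data.Rational.Solver using (module +-*-Solver)
open import Data.Sum.Base using (inj₁; inj₂)
open import Level using (0ℓ)
open import Relation.Binary.Bundles using (Poset)
open import Relation.Binary.PropositionalEquality as ≡ using (_≡_; cong; subst; subst₂)
import Relation.Binary.Reasoning.PartialOrder as PosetReasoning

open +-*-Solver using (solve; _:=_; _:+_; _:*_; :-_; _:-_; con)

-- Rational inequalities

p-q+q≡p : ∀ p q → (p ℚ.- q) ℚ.+ q ≡ p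
p-q+q≡p = solve 2 (λ p q → (p :- q) :+ q := p) ≡.refl

p≤p+q : ∀ {p q} → 0ℚ ℚ.≤ q → p ℚ.≤ p ℚ.+ q
p≤p+q {p} {q} 0≤q = subst (ℚ._≤ p ℚ.+ q) (ℚ.+-identityʳ p) (ℚ.+-monoʳ-≤ p 0≤q)

p≤∣p∣ : ∀ p → p ℚ.≤ ∣ p ∣
p≤∣p∣ p with ℚ.≤-total 0ℚ p
... | inj₁ 0≤p = ℚ.≤-reflexive (≡.sym (ℚ.0≤p⇒∣p∣≡p 0≤p))
... | inj₂ p≤0 = ℚ.≤-trans p≤0 (ℚ.0≤∣p∣ p)

∣p-q∣≡∣q-p∣ : ∀ p q → ∣ p ℚ.- q ∣ ≡ ∣ q ℚ.- p ∣
∣p-q∣≡∣q-p∣ p q = ≡.trans (≡.sym (ℚ.∣-p∣≡∣p∣ (p ℚ.- q)))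
  (cong ∣_∣ (solve 2 (λ p q → :- (p :- q) := q :- p) ≡.refl p q))

p≤q+r⇒p-q≤r : ∀ {p q r} → p ℚ.≤ q ℚ.+ r → p ℚ.- q ℚ.≤ r
p≤q+r⇒p-q≤r {p} {q} {r} p≤q+r = subst (p ℚ.- q ℚ.≤_)
  (solve 2 (λ q r → q :+ r :- q := r) ≡.refl q r) (ℚ.+-monoˡ-≤ (ℚ.- q) p≤q+r)

∣p-q∣≤r⇒p≤q+r : ∀ {p q r} → ∣ p ℚ.- q ∣ ℚ.≤ r → p ℚ.≤ q ℚ.+ r
∣p-q∣≤r⇒p≤q+r {p} {q} {r} ∣p-q∣≤r = subst₂ ℚ._≤_ (p-q+q≡p p q) (ℚ.+-comm r q)
  (ℚ.+-monoˡ-≤ q (ℚ.≤-trans (p≤∣p∣ (p ℚ.- q)) ∣p-q∣≤r))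

p≤q+r∧q≤p+r⇒∣p-q∣≤r : ∀ {p q r} → p ℚ.≤ q ℚ.+ r → q ℚ.≤ p ℚ.+ r → ∣ p ℚ.- q ∣ ℚ.≤ r
p≤q+r∧q≤p+r⇒∣p-q∣≤r {p} {q} {r} p≤q+r q≤p+r with ℚ.≤-total 0ℚ (p ℚ.- q)
... | inj₁ 0≤p-q = subst (ℚ._≤ r) (≡.sym (ℚ.0≤p⇒∣p∣≡p 0≤p-q)) (p≤q+r⇒p-q≤r p≤q+r)
... | inj₂ p-q≤0 = subst (ℚ._≤ r)
  (≡.trans (≡.sym (ℚ.0≤p⇒∣p∣≡p 0≤q-p)) (∣p-q∣≡∣q-p∣ q p)) (p≤q+r⇒p-q≤r q≤p+r)
  where
  0≤q-p : 0ℚ ℚ.≤ q ℚ.- p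
  0≤q-p = subst (0ℚ ℚ.≤_) (solve 2 (λ p q → :- (p :- q) := q :- p) ≡.refl p q)
    (ℚ.neg-antimono-≤ p-q≤0)

0<½ε : ∀ {ε} → 0ℚ ℚ.< ε → 0ℚ ℚ.< ½ ℚ.* ε
0<½ε {ε} 0<ε = ℚ.positive⁻¹ _ {{ℚ.pos*pos⇒pos ½ ε {{ℚ.positive 0<ε}}}}

½ε+½ε : ∀ p ε → (p ℚ.+ ½ ℚ.* ε) ℚ.+ ½ ℚ.* ε ≡ p ℚ.+ ε
½ε+½ε = solve 2 (λ p ε → (p :+ con ½ :* ε) :+ con ½ :* ε := p :+ ε) ≡.refl

Eventually : (ℕ → Set) → Set
Eventually P = ∃ λ N → ∀ n → N ℕ.≤ n → P n

always : ∀ {P} → (∀ n → P n) → Eventually P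
always p = 0 , λ n _ → p n

from : ∀ N → Eventually (N ℕ.≤_)
from N = N , λ _ N≤n → N≤n

map : ∀ {P Q} → (∀ n → P n → Q n) → Eventually P → Eventually Q
map f (N , p) = N , λ n N≤n → f n (p n N≤n)

zipWith : ∀ {P Q S} → (∀ n → P n → Q n → S n) → Eventually P → Eventually Q → Eventually S
zipWith f (M , p) (N , q) = M ℕ.⊔ N , λ n M⊔N≤n →
  f n (p n (ℕ.m⊔n≤o⇒m≤o M N M⊔N≤n)) (q n (ℕ.m⊔n≤o⇒n≤o M N M⊔N≤n))

-- ℝ as an ordered ring with square roots

open _≤_ using (below)
open _≃_ using (close)

≤-pointwise : ∀ {x y} → (∀ n → approx x n ℚ.≤ approx y n) → x ≤ y
below (≤-pointwise {x} {y} x≤y) ε 0<ε = always λ n → ℚ.≤-trans (x≤y n) (p≤p+q (ℚ.<⇒≤ 0<ε))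

≤-trans : ∀ {x y z} → x ≤ y → y ≤ z → x ≤ z
below (≤-trans {x} {y} {z} x≤y y≤z) ε 0<ε = zipWith
  (λ n p q → subst (approx x n ℚ.≤_) (½ε+½ε (approx z n) ε)
    (ℚ.≤-trans p (ℚ.+-monoˡ-≤ (½ ℚ.* ε) q)))
  (below x≤y _ (0<½ε 0<ε)) (below y≤z _ (0<½ε 0<ε))

≤-antisym : ∀ {x y} → x ≤ y → y ≤ x → x ≃ y
close (≤-antisym x≤y y≤x) ε 0<ε =
  zipWith (λ _ → p≤q+r∧q≤p+r⇒∣p-q∣≤r) (below x≤y ε 0<ε) (below y≤x ε 0<ε)

≃⇒≤ : ∀ {x y} → x ≃ y → x ≤ y
below (≃⇒≤ x≃y) ε 0<ε = map (λ _ → ∣p-q∣≤r⇒p≤q+r) (close x≃y ε 0<ε)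

≃-sym : ∀ {x y} → x ≃ y → y ≃ x
close (≃-sym {x} {y} x≃y) ε 0<ε = map
  (λ n → subst (ℚ._≤ ε) (∣p-q∣≡∣q-p∣ (approx x n) (approx y n))) (close x≃y ε 0<ε)

≃-trans : ∀ {x y z} → x ≃ y → y ≃ z → x ≃ z
≃-trans x≃y y≃z = ≤-antisym (≤-trans (≃⇒≤ x≃y) (≃⇒≤ y≃z))
  (≤-trans (≃⇒≤ (≃-sym y≃z)) (≃⇒≤ (≃-sym x≃y)))

≃-pointwise : ∀ {x y} → (∀ n → approx x n ≡ approx y n) → x ≃ y
≃-pointwise x≡y = ≤-antisym (≤-pointwise λ n → ℚ.≤-reflexive (x≡y n))
  (≤-pointwise λ n → ℚ.≤-reflexive (≡.sym (x≡y n)))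

≃-refl : ∀ {x} → x ≃ x
≃-refl = ≃-pointwise λ _ → ≡.refl

≤-refl : ∀ {x} → x ≤ x
≤-refl = ≃⇒≤ ≃-refl

≤-poset : Poset 0ℓ 0ℓ 0ℓ
≤-poset = record
  { Carrier = ℝ
  ; _≈_ = _≃_
  ; _≤_ = _≤_
  ; isPartialOrder = record
    { isPreorder = record
      { isEquivalence = record { refl = ≃-refl ; sym = ≃-sym ; trans = ≃-trans }
      ; reflexive = ≃⇒≤
      ; trans = ≤-trans
      }
    ; antisym = ≤-antisym
    }
  }

module ≤-Reasoning = PosetReasoning ≤-poset

+-mono-≤ : ∀ {x x′ y y′} → x ≤ x′ → y ≤ y′ → x + y ≤ x′ + y′
below (+-mono-≤ {x} {x′} {y} {y′} x≤x′ y≤y′) ε 0<ε = zipWith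
  (λ n p q → subst (approx x n ℚ.+ approx y n ℚ.≤_)
    (solve 3 (λ a b ε → (a :+ con ½ :* ε) :+ (b :+ con ½ :* ε) := a :+ b :+ ε) ≡.refl
      (approx x′ n) (approx y′ n) ε)
    (ℚ.+-mono-≤ p q))
  (below x≤x′ _ (0<½ε 0<ε)) (below y≤y′ _ (0<½ε 0<ε))

+-cong : ∀ {x x′ y y′} → x ≃ x′ → y ≃ y′ → x + y ≃ x′ + y′
+-cong x≃x′ y≃y′ = ≤-antisym (+-mono-≤ (≃⇒≤ x≃x′) (≃⇒≤ y≃y′))
  (+-mono-≤ (≃⇒≤ (≃-sym x≃x′)) (≃⇒≤ (≃-sym y≃y′)))

+-congˡ : ∀ {x y y′} → y ≃ y′ → x + y ≃ x + y′
+-congˡ = +-cong ≃-refl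

+-congʳ : ∀ {x x′ y} → x ≃ x′ → x + y ≃ x′ + y
+-congʳ x≃x′ = +-cong x≃x′ ≃-refl

bounded : ∀ x → ∃ λ B → 0ℚ ℚ.< B × Eventually λ n → ∣ approx x n ∣ ℚ.≤ B
bounded x with cauchy x 1ℚ (ℚ.positive⁻¹ 1ℚ)
... | N , close-to-a = B , 0<B , N , λ n N≤n → begin
  ∣ approx x n ∣                  ≡⟨ cong ∣_∣ (p-q+q≡p _ a) ⟨
  ∣ (approx x n ℚ.- a) ℚ.+ a ∣    ≤⟨ ℚ.∣p+q∣≤∣p∣+∣q∣ (approx x n ℚ.- a) a ⟩
  ∣ approx x n ℚ.- a ∣ ℚ.+ ∣ a ∣  ≤⟨ ℚ.+-monoˡ-≤ ∣ a ∣ (close-to-a n N N≤n ℕ.≤-refl) ⟩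
  B                               ∎
  where
  open ℚ.≤-Reasoning
  a B : ℚ
  a = approx x N
  B = 1ℚ ℚ.+ ∣ a ∣
  0<B : 0ℚ ℚ.< B
  0<B = ℚ.+-mono-<-≤ {0ℚ} {1ℚ} {0ℚ} {∣ a ∣} (ℚ.positive⁻¹ 1ℚ) (ℚ.0≤∣p∣ a)

*-cong : ∀ {x x′ y y′} → x ≃ x′ → y ≃ y′ → x * y ≃ x′ * y′
close (*-cong {x} {x′} {y} {y′} x≃x′ y≃y′) ε 0<ε =
  let A , 0<A , ∣x∣≤A = bounded x
      B , 0<B , ∣y′∣≤B = bounded y′
      δ , 0<δ , Aδ+δB≡ε = split-budget A B ε 0<A 0<B 0<ε
  in zipWith
    (λ n (p , q) (r , s) → subst (_ ℚ.≤_) Aδ+δB≡ε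
      (mul-close A B δ (approx x n) (approx x′ n) (approx y n) (approx y′ n) 0<A 0<δ p q r s))
    (zipWith (λ _ → _,_) ∣x∣≤A ∣y′∣≤B)
    (zipWith (λ _ → _,_) (close x≃x′ δ 0<δ) (close y≃y′ δ 0<δ))

*-congˡ : ∀ {x y y′} → y ≃ y′ → x * y ≃ x * y′
*-congˡ = *-cong ≃-refl

*-congʳ : ∀ {x x′ y} → x ≃ x′ → x * y ≃ x′ * y
*-congʳ x≃x′ = *-cong x≃x′ ≃-refl

-‿cong : ∀ {x y} → x ≃ y → - x ≃ - y
-‿cong {x} {y} x≃y = begin-equality
  - x                   ≈⟨ -1* x ⟨
  fromℚ (ℚ.- 1ℚ) * x    ≈⟨ *-congˡ x≃y ⟩
  fromℚ (ℚ.- 1ℚ) * y    ≈⟨ -1* y ⟩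
  - y                   ∎
  where
  open ≤-Reasoning
  -1* : ∀ x → fromℚ (ℚ.- 1ℚ) * x ≃ - x
  -1* x = ≃-pointwise λ n → solve 1 (λ x → con (ℚ.- 1ℚ) :* x := :- x) ≡.refl (approx x n)

0≤fromℕ : ∀ n → fromℕ 0 ≤ fromℕ n
0≤fromℕ n = ≤-pointwise λ _ → 0≤/ n 1

0≤p² : ∀ p → 0ℚ ℚ.≤ p ℚ.* p
0≤p² p with ℚ.≤-total 0ℚ p
... | inj₁ 0≤p = 0≤-* p p 0≤p 0≤p
... | inj₂ p≤0 = subst (0ℚ ℚ.≤_) (solve 1 (λ p → (:- p) :* (:- p) := p :* p) ≡.refl p)
  (0≤-* (ℚ.- p) (ℚ.- p) (ℚ.neg-antimono-≤ p≤0) (ℚ.neg-antimono-≤ p≤0))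

0≤x² : ∀ x → fromℕ 0 ≤ x * x
0≤x² x = ≤-pointwise λ n → 0≤p² (approx x n)

+-nonNeg : ∀ {x y} → fromℕ 0 ≤ x → fromℕ 0 ≤ y → fromℕ 0 ≤ x + y
+-nonNeg 0≤x 0≤y = ≤-trans (≤-pointwise λ _ → ℚ.≤-refl) (+-mono-≤ 0≤x 0≤y)

x+0≃x : ∀ x → x + fromℕ 0 ≃ x
x+0≃x x = ≃-pointwise λ n → ℚ.+-identityʳ (approx x n)

x≤x+y : ∀ {x y} → fromℕ 0 ≤ y → x ≤ x + y
x≤x+y {x} {y} 0≤y = begin
  x             ≈⟨ x+0≃x x ⟨
  x + fromℕ 0   ≤⟨ +-mono-≤ ≤-refl 0≤y ⟩
  x + y         ∎
  where open ≤-Reasoning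

x⊓y≤x : ∀ x y → x ⊓ y ≤ x
x⊓y≤x x y = ≤-pointwise λ n → ℚ.p⊓q≤p (approx x n) (approx y n)

x⊓y≤y : ∀ x y → x ⊓ y ≤ y
x⊓y≤y x y = ≤-pointwise λ n → ℚ.p⊓q≤q (approx x n) (approx y n)

⊓-glb : ∀ {x y z} → z ≤ x → z ≤ y → z ≤ x ⊓ y
below (⊓-glb {x} {y} {z} z≤x z≤y) ε 0<ε = zipWith
  (λ n p q → subst (approx z n ℚ.≤_)
    (≡.sym (ℚ.mono-≤-distrib-⊓ (ℚ.+-monoˡ-≤ ε) (approx x n) (approx y n))) (ℚ.⊓-glb p q))
  (below z≤x ε 0<ε) (below z≤y ε 0<ε)

square-cancel-≤ : ∀ {x y} → fromℕ 0 ≤ y → x * x ≤ y * y → x ≤ y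
below (square-cancel-≤ {x} {y} 0≤y x²≤y²) ε 0<ε = zipWith
  (λ n p q → rational (approx x n) (approx y n) q p)
  (below 0≤y η 0<η) (below x²≤y² (η ℚ.* η) 0<η²)
  where
  η : ℚ
  η = ½ ℚ.* (½ ℚ.* ε)
  0<η : 0ℚ ℚ.< η
  0<η = 0<½ε (0<½ε 0<ε)
  0≤η : 0ℚ ℚ.≤ η
  0≤η = ℚ.<⇒≤ 0<η
  0<η² : 0ℚ ℚ.< η ℚ.* η
  0<η² = ℚ.positive⁻¹ _ {{ℚ.pos*pos⇒pos η {{ℚ.positive 0<η}} η {{ℚ.positive 0<η}}}}
  rational : ∀ p q → p ℚ.* p ℚ.≤ q ℚ.* q ℚ.+ η ℚ.* η → 0ℚ ℚ.≤ q ℚ.+ η → p ℚ.≤ q ℚ.+ ε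
  rational p q p²≤q²+η² 0≤q+η = begin
    p ≤⟨ root-close (p ℚ.* p) (q ℚ.* q) (η ℚ.* η) η p (q ℚ.+ (η ℚ.+ η))
           (ℚ.<⇒≤ 0<η²) 0≤η 0≤q+2η ≡.refl (ℚ.p≤q⊔p 0ℚ (p ℚ.* p)) q²≤ p²≤q²+η² ⟩
    q ℚ.+ (η ℚ.+ η) ℚ.+ η            ≤⟨ p≤p+q 0≤η ⟩
    q ℚ.+ (η ℚ.+ η) ℚ.+ η ℚ.+ η      ≡⟨ solve 2 (λ q ε → let η = con ½ :* (con ½ :* ε) in
                                          q :+ (η :+ η) :+ η :+ η := q :+ ε) ≡.refl q ε ⟩
    q ℚ.+ ε                          ∎
    where
    open ℚ.≤-Reasoning
    expand : ∀ q η → q ℚ.* q ℚ.+ (η ℚ.+ η ℚ.+ (η ℚ.+ η)) ℚ.* (q ℚ.+ η) ≡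
                     (q ℚ.+ (η ℚ.+ η)) ℚ.* (q ℚ.+ (η ℚ.+ η))
    expand = solve 2 (λ q η → q :* q :+ (η :+ η :+ (η :+ η)) :* (q :+ η) :=
                              (q :+ (η :+ η)) :* (q :+ (η :+ η))) ≡.refl
    0≤q+2η : 0ℚ ℚ.≤ q ℚ.+ (η ℚ.+ η)
    0≤q+2η = subst (0ℚ ℚ.≤_) (ℚ.+-assoc q η η) (0≤-+ _ _ 0≤q+η 0≤η)
    0≤4η : 0ℚ ℚ.≤ η ℚ.+ η ℚ.+ (η ℚ.+ η)
    0≤4η = 0≤-+ _ _ (0≤-+ _ _ 0≤η 0≤η) (0≤-+ _ _ 0≤η 0≤η)
    q²≤ : 0ℚ ℚ.⊔ q ℚ.* q ℚ.≤ (q ℚ.+ (η ℚ.+ η)) ℚ.* (q ℚ.+ (η ℚ.+ η))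
    q²≤ = ℚ.⊔-lub (0≤p² (q ℚ.+ (η ℚ.+ η))) (subst (q ℚ.* q ℚ.≤_) (expand q η)
      (p≤p+q (0≤-* _ _ 0≤4η 0≤q+η)))

√-nonNeg : ∀ x → fromℕ 0 ≤ √ x
√-nonNeg x = ≤-pointwise λ n → sqrtℚ-nonNeg (ℕ.suc n) (approx x n)

√²≤ : ∀ {x} → fromℕ 0 ≤ x → √ x * √ x ≤ x
below (√²≤ {x} 0≤x) ε 0<ε = map
  (λ n 0≤x+ε → ℚ.≤-trans (sqrtℚ-lower (ℕ.suc n) (approx x n))
    (ℚ.⊔-lub 0≤x+ε (p≤p+q {approx x n} (ℚ.<⇒≤ 0<ε))))
  (below 0≤x ε 0<ε)

≤√² : ∀ x → x ≤ √ x * √ x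
below (≤√² x) ε 0<ε =
  let B , 0<B , ∣√x∣≤B = bounded (√ x)
      0<B+1 = ℚ.+-mono-< {0ℚ} {B} {0ℚ} {1ℚ} 0<B (ℚ.positive⁻¹ 1ℚ)
      η , 0<η , budget = split-budget (B ℚ.+ 1ℚ) B ε 0<B+1 0<B 0<ε
  in zipWith
    (λ n r≤B (↧η≤n , 1≤n) →
      let r = approx (√ x) n
          δ = + 1 ℚ./ ℕ.suc n
          ∣δ∣≡δ = ℚ.0≤p⇒∣p∣≡p (0≤/ 1 (ℕ.suc n))
          δ≤1 = 1/suc≤ 1ℚ (ℚ.positive⁻¹ 1ℚ) n 1≤n
          ∣r+δ∣≤B+1 = ℚ.≤-trans (ℚ.∣p+q∣≤∣p∣+∣q∣ r δ)
            (ℚ.+-mono-≤ r≤B (subst (ℚ._≤ 1ℚ) (≡.sym ∣δ∣≡δ) δ≤1))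
          r+δ-r≤η = subst (ℚ._≤ η)
            (≡.trans (≡.sym ∣δ∣≡δ) (cong ∣_∣ (solve 2 (λ r δ → δ := r :+ δ :- r) ≡.refl r δ)))
            (1/suc≤ η 0<η n ↧η≤n)
      in ℚ.≤-trans (ℚ.≤-trans (ℚ.p≤q⊔p 0ℚ (approx x n)) (sqrtℚ-upper (ℕ.suc n) (approx x n)))
        (∣p-q∣≤r⇒p≤q+r (subst (_ ℚ.≤_) budget
          (mul-close (B ℚ.+ 1ℚ) B η (r ℚ.+ δ) r (r ℚ.+ δ) r 0<B+1 0<η
            ∣r+δ∣≤B+1 r≤B r+δ-r≤η r+δ-r≤η))))
    ∣√x∣≤B (zipWith (λ _ → _,_) (from (ℚ.↧ₙ η)) (from 1))

√-square : ∀ {x} → fromℕ 0 ≤ x → √ x * √ x ≃ x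
√-square 0≤x = ≤-antisym (√²≤ 0≤x) (≤√² _)

√-unique : ∀ {x y} → fromℕ 0 ≤ y → y * y ≃ x → √ x ≃ y
√-unique {x} {y} 0≤y y²≃x = ≤-antisym
  (square-cancel-≤ 0≤y (≃⇒≤ √x²≃y²)) (square-cancel-≤ (√-nonNeg x) (≃⇒≤ (≃-sym √x²≃y²)))
  where
  √x²≃y² : √ x * √ x ≃ y * y
  √x²≃y² = ≃-trans (√-square (≤-trans (0≤x² y) (≃⇒≤ y²≃x))) (≃-sym y²≃x)

*-nonNeg : ∀ {x y} → fromℕ 0 ≤ x → fromℕ 0 ≤ y → fromℕ 0 ≤ x * y
*-nonNeg {x} {y} 0≤x 0≤y = begin
  fromℕ 0                      ≤⟨ 0≤x² (√ x * √ y) ⟩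
  (√ x * √ y) * (√ x * √ y)    ≈⟨ ≃-pointwise (λ n → interchange (approx (√ x) n) (approx (√ y) n)) ⟩
  (√ x * √ x) * (√ y * √ y)    ≈⟨ *-cong (√-square 0≤x) (√-square 0≤y) ⟩
  x * y                        ∎
  where
  open ≤-Reasoning
  interchange : ∀ p q → (p ℚ.* q) ℚ.* (p ℚ.* q) ≡ (p ℚ.* p) ℚ.* (q ℚ.* q)
  interchange = solve 2 (λ p q → (p :* q) :* (p :* q) := (p :* p) :* (q :* q)) ≡.refl

double-cancel-≤ : ∀ {x y} → x + x ≤ y + y → x ≤ y
below (double-cancel-≤ {x} {y} 2x≤2y) ε 0<ε = map
  (λ n p → subst₂ ℚ._≤_
    (solve 1 (λ p → con ½ :* (p :+ p) := p) ≡.refl (approx x n))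
    (solve 2 (λ q ε → con ½ :* (q :+ q :+ (ε :+ ε)) := q :+ ε) ≡.refl (approx y n) ε)
    (ℚ.*-monoˡ-≤-nonNeg ½ p))
  (below 2x≤2y (ε ℚ.+ ε) (ℚ.+-mono-< 0<ε 0<ε))

x+e*y≃x : ∀ {e} → e ≃ fromℕ 0 → ∀ x y → x + e * y ≃ x
x+e*y≃x {e} e≃0 x y = begin-equality
  x + e * y          ≈⟨ +-congˡ (*-congʳ e≃0) ⟩
  x + fromℕ 0 * y    ≈⟨ ≃-pointwise (λ n → solve 2 (λ x y → x :+ con 0ℚ :* y := x) ≡.refl (approx x n) (approx y n)) ⟩
  x                  ∎
  where open ≤-Reasoning

-- Chords of the unit circle

square : ℝ → ℝ
square x = x * x

d-nonNeg : ∀ P Q → fromℕ 0 ≤ d P Q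
d-nonNeg P Q = √-nonNeg _

d-square : ∀ {x₁ y₁ x₂ y₂} →
  square (d (x₁ , y₁) (x₂ , y₂)) ≃ square (x₁ - x₂) + square (y₁ - y₂)
d-square = √-square (+-nonNeg (0≤x² _) (0≤x² _))

d-comm : ∀ P Q → d P Q ≃ d Q P
d-comm P@(x₁ , y₁) Q@(x₂ , y₂) = √-unique (d-nonNeg Q P) (≃-trans d-square
  (≃-pointwise λ n → solve 4 (λ x₁ y₁ x₂ y₂ →
    (x₂ :- x₁) :* (x₂ :- x₁) :+ (y₂ :- y₁) :* (y₂ :- y₁) :=
    (x₁ :- x₂) :* (x₁ :- x₂) :+ (y₁ :- y₂) :* (y₁ :- y₂)) ≡.refl
    (approx x₁ n) (approx y₁ n) (approx x₂ n) (approx y₂ n)))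

x-0≃x : ∀ x → x - fromℕ 0 ≃ x
x-0≃x x = ≃-pointwise λ n → solve 1 (λ x → x :- con 0ℚ := x) ≡.refl (approx x n)

circle-equation : ∀ {x y} → OnUnitCircle (x , y) → square x + square y ≃ fromℕ 1
circle-equation {x} {y} P∈𝒞 = begin-equality
  square x + square y
    ≈⟨ +-cong (*-cong (x-0≃x x) (x-0≃x x)) (*-cong (x-0≃x y) (x-0≃x y)) ⟨
  square (x - fromℕ 0) + square (y - fromℕ 0)      ≈⟨ d-square ⟨
  square (d (x , y) (fromℕ 0 , fromℕ 0))           ≈⟨ *-cong P∈𝒞 P∈𝒞 ⟩
  square (fromℕ 1)                                 ≈⟨ ≃-pointwise (λ _ → ≡.refl) ⟩
  fromℕ 1                                          ∎
  where open ≤-Reasoning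

circle-equation⁻ : ∀ {x y} → square x + square y ≃ fromℕ 1 → OnUnitCircle (x , y)
circle-equation⁻ {x} {y} x²+y²≃1 = √-unique (0≤fromℕ 1) (begin-equality
  square (fromℕ 1)                                 ≈⟨ ≃-pointwise (λ _ → ≡.refl) ⟩
  fromℕ 1                                          ≈⟨ x²+y²≃1 ⟨
  square x + square y
    ≈⟨ +-cong (*-cong (x-0≃x x) (x-0≃x x)) (*-cong (x-0≃x y) (x-0≃x y)) ⟨
  square (x - fromℕ 0) + square (y - fromℕ 0)      ∎)
  where open ≤-Reasoning

d-R-square : ∀ {x y} → square x + square y ≃ fromℕ 1 →
  square (fromℕ 1 - x) + square (fromℕ 0 - y) ≃ fromℕ 2 - fromℕ 2 * x
d-R-square {x} {y} x²+y²≃1 = begin-equality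
  square (fromℕ 1 - x) + square (fromℕ 0 - y)
    ≈⟨ ≃-pointwise (λ n → solve 2 (λ x y →
         (con 1ℚ :- x) :* (con 1ℚ :- x) :+ (con 0ℚ :- y) :* (con 0ℚ :- y) :=
         (x :* x :+ y :* y) :+ (con 1ℚ :- con (+ 2 ℚ./ 1) :* x)) ≡.refl (approx x n) (approx y n)) ⟩
  (square x + square y) + (fromℕ 1 - fromℕ 2 * x)
    ≈⟨ +-congʳ x²+y²≃1 ⟩
  fromℕ 1 + (fromℕ 1 - fromℕ 2 * x)
    ≈⟨ ≃-pointwise (λ n → solve 1 (λ x →
         con 1ℚ :+ (con 1ℚ :- con (+ 2 ℚ./ 1) :* x) := con (+ 2 ℚ./ 1) :- con (+ 2 ℚ./ 1) :* x) ≡.refl (approx x n)) ⟩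
  fromℕ 2 - fromℕ 2 * x ∎
  where open ≤-Reasoning

module Optimum
  (κ ρ : ℝ) (0≤κ : fromℕ 0 ≤ κ) (0≤ρ : fromℕ 0 ≤ ρ)
  (κ-root : fromℕ 2 * square κ + κ ≃ fromℕ 4) (ρ-square : square ρ ≃ fromℕ 4 - square κ)
  where

  optimum : ℝ
  optimum = ρ * (fromℕ 1 + κ)

  E : ℝ
  E = fromℕ 2 * square κ + κ - fromℕ 4

  E≃0 : E ≃ fromℕ 0
  E≃0 = ≃-trans (+-congʳ κ-root) (≃-pointwise λ _ → ≡.refl)

  -- (p (1 + q))² when p² + q² = 4
  quartic : ℝ → ℝ
  quartic q = (fromℕ 4 - square q) * square (fromℕ 1 + q)

  quartic-max : ∀ {q} → fromℕ 0 ≤ q → quartic q ≤ square optimum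
  quartic-max {q} 0≤q = begin
    quartic q
      ≤⟨ x≤x+y (*-nonNeg (0≤x² (q - κ)) 0≤cofactor) ⟩
    quartic q + square (q - κ) * cofactor
      ≈⟨ x+e*y≃x E≃0 _ _ ⟨
    quartic q + square (q - κ) * cofactor
      + E * (fromℚ (+ 3 ℚ./ 2) * square (q - κ) + (q - κ) * (fromℕ 2 * κ + fromℕ 2))
      ≈⟨ ≃-pointwise (λ n → factorisation (approx q n) (approx κ n)) ⟩
    quartic κ
      ≈⟨ *-congʳ ρ-square ⟨
    square ρ * square (fromℕ 1 + κ)
      ≈⟨ ≃-pointwise (λ n → solve 2 (λ p q → (p :* p) :* (q :* q) := (p :* q) :* (p :* q)) ≡.refl
           (approx ρ n) (approx (fromℕ 1 + κ) n)) ⟩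
    square optimum ∎
    where
    open ≤-Reasoning
    -- The quotient of quartic κ − quartic q by its double root q = κ, reduced
    -- modulo E so that its coefficients are visibly nonnegative.
    cofactor : ℝ
    cofactor = square q + (fromℕ 2 + fromℕ 2 * κ) * q + (fromℕ 3 + fromℚ (+ 5 ℚ./ 2) * κ)
    0≤cofactor : fromℕ 0 ≤ cofactor
    0≤cofactor = +-nonNeg
      (+-nonNeg (0≤x² q) (*-nonNeg (+-nonNeg (0≤fromℕ 2) (*-nonNeg (0≤fromℕ 2) 0≤κ)) 0≤q))
      (+-nonNeg (0≤fromℕ 3) (*-nonNeg (≤-pointwise λ _ → 0≤/ 5 2) 0≤κ))
    factorisation : ∀ q κ → _
    factorisation = solve 2 (λ q κ →
      let e = con (+ 2 ℚ./ 1) :* (κ :* κ) :+ κ :- con (+ 4 ℚ./ 1)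
          quartic q = (con (+ 4 ℚ./ 1) :- q :* q) :* ((con 1ℚ :+ q) :* (con 1ℚ :+ q))
          s = (q :- κ) :* (q :- κ)
      in quartic q :+ s :* (q :* q :+ (con (+ 2 ℚ./ 1) :+ con (+ 2 ℚ./ 1) :* κ) :* q
            :+ (con (+ 3 ℚ./ 1) :+ con (+ 5 ℚ./ 2) :* κ))
          :+ e :* (con (+ 3 ℚ./ 2) :* s :+ (q :- κ) :* (con (+ 2 ℚ./ 1) :* κ :+ con (+ 2 ℚ./ 1)))
         := quartic κ) ≡.refl

  module _ {x₁ y₁ x₂ y₂ : ℝ}
    (P₁∈𝒞 : OnUnitCircle (x₁ , y₁)) (P₂∈𝒞 : OnUnitCircle (x₂ , y₂)) where

    private
      open ≤-Reasoning
      P₁ P₂ : Point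
      P₁ = x₁ , y₁
      P₂ = x₂ , y₂
      a b t w p q : ℝ
      a = d R P₁
      b = d R P₂
      t = d P₁ P₂
      -- w = |P₁ + P₂|; always t = pq, and a = b = p in the extremal configuration.
      w = √ (square (x₁ + x₂) + square (y₁ + y₂))
      p = √ (fromℕ 2 + w)
      q = √ (fromℕ 2 - w)

      w-square : square w ≃ square (x₁ + x₂) + square (y₁ + y₂)
      w-square = √-square (+-nonNeg (0≤x² _) (0≤x² _))

      parallelogram : square w + square t ≃ fromℕ 4
      parallelogram = begin-equality
        square w + square t
          ≈⟨ +-cong w-square d-square ⟩
        square (x₁ + x₂) + square (y₁ + y₂) + (square (x₁ - x₂) + square (y₁ - y₂))
          ≈⟨ ≃-pointwise (λ n → solve 4 (λ x₁ y₁ x₂ y₂ →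
               (x₁ :+ x₂) :* (x₁ :+ x₂) :+ (y₁ :+ y₂) :* (y₁ :+ y₂)
                 :+ ((x₁ :- x₂) :* (x₁ :- x₂) :+ (y₁ :- y₂) :* (y₁ :- y₂)) :=
               con (+ 2 ℚ./ 1) :* ((x₁ :* x₁ :+ y₁ :* y₁) :+ (x₂ :* x₂ :+ y₂ :* y₂))) ≡.refl
               (approx x₁ n) (approx y₁ n) (approx x₂ n) (approx y₂ n)) ⟩
        fromℕ 2 * ((square x₁ + square y₁) + (square x₂ + square y₂))
          ≈⟨ *-congˡ (+-cong (circle-equation P₁∈𝒞) (circle-equation P₂∈𝒞)) ⟩
        fromℕ 2 * (fromℕ 1 + fromℕ 1)
          ≈⟨ ≃-pointwise (λ _ → ≡.refl) ⟩
        fromℕ 4 ∎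

      w≤2 : w ≤ fromℕ 2
      w≤2 = square-cancel-≤ (0≤fromℕ 2) (begin
        square w               ≤⟨ x≤x+y (0≤x² t) ⟩
        square w + square t    ≈⟨ parallelogram ⟩
        fromℕ 4                ≈⟨ ≃-pointwise (λ _ → ≡.refl) ⟩
        square (fromℕ 2)       ∎)

      -[x₁+x₂]≤w : - (x₁ + x₂) ≤ w
      -[x₁+x₂]≤w = square-cancel-≤ (√-nonNeg _) (begin
        square (- (x₁ + x₂))
          ≈⟨ ≃-pointwise (λ n → solve 1 (λ s → (:- s) :* (:- s) := s :* s) ≡.refl (approx (x₁ + x₂) n)) ⟩
        square (x₁ + x₂)                        ≤⟨ x≤x+y (0≤x² _) ⟩
        square (x₁ + x₂) + square (y₁ + y₂)     ≈⟨ w-square ⟨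
        square w                                ∎)

      p-square : square p ≃ fromℕ 2 + w
      p-square = √-square (+-nonNeg (0≤fromℕ 2) (√-nonNeg _))

      q-square : square q ≃ fromℕ 2 - w
      q-square = √-square (begin
        fromℕ 0      ≈⟨ ≃-pointwise (λ n → ≡.sym (ℚ.+-inverseʳ (approx w n))) ⟩
        w - w        ≤⟨ +-mono-≤ w≤2 ≤-refl ⟩
        fromℕ 2 - w  ∎)

      p²+q²≃4 : square p + square q ≃ fromℕ 4
      p²+q²≃4 = ≃-trans (+-cong p-square q-square) (≃-pointwise λ n →
        solve 1 (λ w → con (+ 2 ℚ./ 1) :+ w :+ (con (+ 2 ℚ./ 1) :- w) := con (+ 4 ℚ./ 1)) ≡.refl (approx w n))

      t≤pq : t ≤ p * q
      t≤pq = square-cancel-≤ (*-nonNeg (√-nonNeg _) (√-nonNeg _)) (≃⇒≤ (begin-equality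
        square t
          ≈⟨ ≃-pointwise (λ n → solve 2 (λ t w → t := w :+ t :- w) ≡.refl
               (approx (square t) n) (approx (square w) n)) ⟩
        square w + square t - square w
          ≈⟨ +-congʳ parallelogram ⟩
        fromℕ 4 - square w
          ≈⟨ ≃-pointwise (λ n → solve 1 (λ w → con (+ 4 ℚ./ 1) :- w :* w :=
               (con (+ 2 ℚ./ 1) :+ w) :* (con (+ 2 ℚ./ 1) :- w)) ≡.refl (approx w n)) ⟩
        (fromℕ 2 + w) * (fromℕ 2 - w)
          ≈⟨ *-cong p-square q-square ⟨
        square p * square q
          ≈⟨ ≃-pointwise (λ n → solve 2 (λ p q → (p :* p) :* (q :* q) := (p :* q) :* (p :* q)) ≡.refl
               (approx p n) (approx q n)) ⟩
        square (p * q) ∎))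

      a+b≤2p : a + b ≤ p + p
      a+b≤2p = square-cancel-≤ (+-nonNeg (√-nonNeg _) (√-nonNeg _)) (begin
        square (a + b)
          ≤⟨ x≤x+y (0≤x² (a - b)) ⟩
        square (a + b) + square (a - b)
          ≈⟨ ≃-pointwise (λ n → solve 2 (λ a b →
               (a :+ b) :* (a :+ b) :+ (a :- b) :* (a :- b) :=
               con (+ 2 ℚ./ 1) :* (a :* a :+ b :* b)) ≡.refl (approx a n) (approx b n)) ⟩
        fromℕ 2 * (square a + square b)
          ≈⟨ *-congˡ (+-cong (chord P₁∈𝒞) (chord P₂∈𝒞)) ⟩
        fromℕ 2 * ((fromℕ 2 - fromℕ 2 * x₁) + (fromℕ 2 - fromℕ 2 * x₂))
          ≈⟨ ≃-pointwise (λ n → solve 2 (λ x₁ x₂ →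
               let 2′ = con (+ 2 ℚ./ 1) ; s = :- (x₁ :+ x₂) in
               2′ :* ((2′ :- 2′ :* x₁) :+ (2′ :- 2′ :* x₂)) :=
               con (+ 8 ℚ./ 1) :+ (s :+ s :+ (s :+ s))) ≡.refl (approx x₁ n) (approx x₂ n)) ⟩
        fromℕ 8 + (s + s + (s + s))
          ≤⟨ +-mono-≤ ≤-refl (+-mono-≤ 2s≤2w 2s≤2w) ⟩
        fromℕ 8 + (w + w + (w + w))
          ≈⟨ ≃-pointwise (λ n → solve 1 (λ w →
               con (+ 8 ℚ./ 1) :+ (w :+ w :+ (w :+ w)) :=
               con (+ 4 ℚ./ 1) :* (con (+ 2 ℚ./ 1) :+ w)) ≡.refl (approx w n)) ⟩
        fromℕ 4 * (fromℕ 2 + w)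
          ≈⟨ *-congˡ p-square ⟨
        fromℕ 4 * square p
          ≈⟨ ≃-pointwise (λ n → solve 1 (λ p →
               con (+ 4 ℚ./ 1) :* (p :* p) := (p :+ p) :* (p :+ p)) ≡.refl (approx p n)) ⟩
        square (p + p) ∎)
        where
        s : ℝ
        s = - (x₁ + x₂)
        2s≤2w : s + s ≤ w + w
        2s≤2w = +-mono-≤ -[x₁+x₂]≤w -[x₁+x₂]≤w
        chord : ∀ {x y} → OnUnitCircle (x , y) → square (d R (x , y)) ≃ fromℕ 2 - fromℕ 2 * x
        chord P∈𝒞 = ≃-trans d-square (d-R-square (circle-equation P∈𝒞))

      p[1+q]≤optimum : p * (fromℕ 1 + q) ≤ optimum
      p[1+q]≤optimum = square-cancel-≤ (*-nonNeg 0≤ρ (+-nonNeg (0≤fromℕ 1) 0≤κ)) (begin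
        square (p * (fromℕ 1 + q))
          ≈⟨ ≃-pointwise (λ n → solve 2 (λ p q →
               (p :* (con 1ℚ :+ q)) :* (p :* (con 1ℚ :+ q)) :=
               (p :* p :+ q :* q :- q :* q) :* ((con 1ℚ :+ q) :* (con 1ℚ :+ q))) ≡.refl
               (approx p n) (approx q n)) ⟩
        (square p + square q - square q) * square (fromℕ 1 + q)
          ≈⟨ *-congʳ (+-congʳ p²+q²≃4) ⟩
        quartic q
          ≤⟨ quartic-max (√-nonNeg _) ⟩
        square optimum ∎)

    paths≤ : (d R P₁ + d P₁ P₂) + (d R P₂ + d P₁ P₂) ≤ optimum + optimum
    paths≤ = begin
      (a + t) + (b + t)
        ≈⟨ ≃-pointwise (λ n → solve 3 (λ a b t → (a :+ t) :+ (b :+ t) := (a :+ b) :+ (t :+ t)) ≡.refl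
             (approx a n) (approx b n) (approx t n)) ⟩
      (a + b) + (t + t)
        ≤⟨ +-mono-≤ a+b≤2p (+-mono-≤ t≤pq t≤pq) ⟩
      (p + p) + (p * q + p * q)
        ≈⟨ ≃-pointwise (λ n → solve 2 (λ p q → let p[1+q] = p :* (con 1ℚ :+ q) in
             (p :+ p) :+ (p :* q :+ p :* q) := p[1+q] :+ p[1+q]) ≡.refl (approx p n) (approx q n)) ⟩
      p * (fromℕ 1 + q) + p * (fromℕ 1 + q)
        ≤⟨ +-mono-≤ p[1+q]≤optimum p[1+q]≤optimum ⟩
      optimum + optimum ∎

  shortestPath≤optimum : ∀ T → shortestPath {2} T ≤ optimum
  shortestPath≤optimum T = double-cancel-≤ (begin
    shortestPath T + shortestPath T
      ≤⟨ +-mono-≤ (x⊓y≤x via-P via-Q) (x⊓y≤y via-P via-Q) ⟩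
    (d R P + (d P Q + fromℕ 0)) + (d R Q + (d Q P + fromℕ 0))
      ≈⟨ +-cong (+-congˡ (x+0≃x _)) (+-congˡ (x+0≃x _)) ⟩
    (d R P + d P Q) + (d R Q + d Q P)
      ≈⟨ +-congˡ (+-congˡ (d-comm Q P)) ⟩
    (d R P + d P Q) + (d R Q + d P Q)
      ≤⟨ paths≤ (proj₂ (T zero)) (proj₂ (T (suc zero))) ⟩
    optimum + optimum ∎)
    where
    open ≤-Reasoning
    P Q : Point
    P = proj₁ (T zero)
    Q = proj₁ (T (suc zero))
    via-P via-Q : ℝ
    via-P = d R P + (d P Q + fromℕ 0)
    via-Q = d R Q + (d Q P + fromℕ 0)

  private
    -- (cos θ , sin θ) for the angle θ with 2 cos (θ/2) = κ and 2 sin (θ/2) = ρ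
    X Y : ℝ
    X = fromℚ (ℚ.- (+ 1 ℚ./ 4)) * κ
    Y = fromℚ ½ * (κ * ρ)

    ρ²≃2-2X : square ρ ≃ fromℕ 2 - fromℕ 2 * X
    ρ²≃2-2X = begin-equality
      square ρ              ≈⟨ ρ-square ⟩
      fromℕ 4 - square κ    ≈⟨ x+e*y≃x E≃0 _ _ ⟨
      fromℕ 4 - square κ + E * fromℚ ½
        ≈⟨ ≃-pointwise (λ n → solve 1 (λ κ →
             con (+ 4 ℚ./ 1) :- κ :* κ :+ (con (+ 2 ℚ./ 1) :* (κ :* κ) :+ κ :- con (+ 4 ℚ./ 1)) :* con ½ :=
             con (+ 2 ℚ./ 1) :- con (+ 2 ℚ./ 1) :* (con (ℚ.- (+ 1 ℚ./ 4)) :* κ)) ≡.refl (approx κ n)) ⟩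
      fromℕ 2 - fromℕ 2 * X ∎
      where open ≤-Reasoning

    X²+Y²≃1 : square X + square Y ≃ fromℕ 1
    X²+Y²≃1 = begin-equality
      square X + square Y
        ≈⟨ ≃-pointwise (λ n → solve 2 (λ κ ρ →
             let X = con (ℚ.- (+ 1 ℚ./ 4)) :* κ ; Y = con ½ :* (κ :* ρ) in
             X :* X :+ Y :* Y := X :* X :+ (con (+ 1 ℚ./ 4) :* (κ :* κ)) :* (ρ :* ρ)) ≡.refl
             (approx κ n) (approx ρ n)) ⟩
      square X + fromℚ (+ 1 ℚ./ 4) * square κ * square ρ
        ≈⟨ +-congˡ (*-congˡ ρ-square) ⟩
      square X + fromℚ (+ 1 ℚ./ 4) * square κ * (fromℕ 4 - square κ)
        ≈⟨ ≃-pointwise (λ n → solve 1 (λ κ →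
             let X = con (ℚ.- (+ 1 ℚ./ 4)) :* κ ; κ² = κ :* κ in
             X :* X :+ con (+ 1 ℚ./ 4) :* κ² :* (con (+ 4 ℚ./ 1) :- κ²) :=
             con 1ℚ :+ (con (+ 2 ℚ./ 1) :* κ² :+ κ :- con (+ 4 ℚ./ 1))
               :* (con (ℚ.- (+ 1 ℚ./ 8)) :* κ² :+ con (+ 1 ℚ./ 16) :* κ :+ con (+ 1 ℚ./ 4))) ≡.refl
             (approx κ n)) ⟩
      fromℕ 1 + E * (fromℚ (ℚ.- (+ 1 ℚ./ 8)) * square κ + fromℚ (+ 1 ℚ./ 16) * κ + fromℚ (+ 1 ℚ./ 4))
        ≈⟨ x+e*y≃x E≃0 _ _ ⟩
      fromℕ 1 ∎
      where open ≤-Reasoning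

    X²+[-Y]²≃1 : square X + square (- Y) ≃ fromℕ 1
    X²+[-Y]²≃1 = ≃-trans (+-congˡ (≃-pointwise λ n →
      solve 1 (λ y → (:- y) :* (:- y) := y :* y) ≡.refl (approx Y n))) X²+Y²≃1

    P⁺ P⁻ : Point
    P⁺ = X , Y
    P⁻ = X , - Y

    d-R≃ρ : ∀ {y} → square X + square y ≃ fromℕ 1 → d R (X , y) ≃ ρ
    d-R≃ρ X²+y²≃1 = √-unique 0≤ρ (≃-trans ρ²≃2-2X (≃-sym (d-R-square X²+y²≃1)))

    d-P⁺-P⁻ : d P⁺ P⁻ ≃ κ * ρ
    d-P⁺-P⁻ = √-unique (*-nonNeg 0≤κ 0≤ρ) (≃-pointwise λ n → solve 3 (λ κ ρ x →
      let y = con ½ :* (κ :* ρ) in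
      (κ :* ρ) :* (κ :* ρ) := (x :- x) :* (x :- x) :+ (y :- (:- y)) :* (y :- (:- y))) ≡.refl
      (approx κ n) (approx ρ n) (approx X n))

    optimum≤path : ∀ {P Q} → d R P ≃ ρ → d P Q ≃ κ * ρ → optimum ≤ d R P + (d P Q + fromℕ 0)
    optimum≤path {P} {Q} d-R-P d-P-Q = ≃⇒≤ (begin-equality
      optimum
        ≈⟨ ≃-pointwise (λ n → solve 2 (λ κ ρ → ρ :* (con 1ℚ :+ κ) := ρ :+ (κ :* ρ :+ con 0ℚ)) ≡.refl
             (approx κ n) (approx ρ n)) ⟩
      ρ + (κ * ρ + fromℕ 0)             ≈⟨ +-cong d-R-P (+-congʳ d-P-Q) ⟨
      d R P + (d P Q + fromℕ 0)         ∎)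
      where open ≤-Reasoning

    extremal : Fin 2 → 𝒞
    extremal zero       = P⁺ , circle-equation⁻ X²+Y²≃1
    extremal (suc zero) = P⁻ , circle-equation⁻ X²+[-Y]²≃1

    optimum≤extremal : optimum ≤ shortestPath extremal
    optimum≤extremal = ⊓-glb
      (optimum≤path {P⁺} {P⁻} (d-R≃ρ X²+Y²≃1) d-P⁺-P⁻)
      (optimum≤path {P⁻} {P⁺} (d-R≃ρ X²+[-Y]²≃1) (≃-trans (d-comm P⁻ P⁺) d-P⁺-P⁻))

  optimum-is-c₂ : Is-c 2 optimum
  optimum-is-c₂ = shortestPath≤optimum , λ u shortestPath≤u →
    ≤-trans optimum≤extremal (shortestPath≤u extremal)

IsSupremum-resp-≃ : ∀ {A : Set} {f : A → ℝ} {s s′} → s ≃ s′ → IsSupremum f s → IsSupremum f s′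
IsSupremum-resp-≃ s≃s′ (f≤s , s-least) =
  (λ a → ≤-trans (f≤s a) (≃⇒≤ s≃s′)) , λ u f≤u → ≤-trans (≃⇒≤ (≃-sym s≃s′)) (s-least u f≤u)

lemma3 : Is-c 2 ((√ (fromℕ 33) + fromℕ 3) / 16 * √ (fromℕ 30 + fromℕ 2 * √ (fromℕ 33)))
lemma3 = IsSupremum-resp-≃ optimum≃c₂ (Optimum.optimum-is-c₂ κ ρ 0≤κ 0≤ρ κ-root ρ-square)
  where
  open ≤-Reasoning
  ¼ : ℚ
  ¼ = + 1 ℚ./ 4
  s r κ ρ : ℝ
  s = √ (fromℕ 33)
  r = √ (fromℕ 30 + fromℕ 2 * s)
  κ = (s - fromℕ 1) * fromℚ ¼
  ρ = r * fromℚ ¼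

  0≤¼ : fromℕ 0 ≤ fromℚ ¼
  0≤¼ = ≤-pointwise λ _ → 0≤/ 1 4

  s-square : square s ≃ fromℕ 33
  s-square = √-square (0≤fromℕ 33)

  r-square : square r ≃ fromℕ 30 + fromℕ 2 * s
  r-square = √-square (+-nonNeg (0≤fromℕ 30) (*-nonNeg (0≤fromℕ 2) (√-nonNeg _)))

  1≤s : fromℕ 1 ≤ s
  1≤s = square-cancel-≤ (√-nonNeg _) (begin
    square (fromℕ 1)        ≤⟨ x≤x+y (0≤fromℕ 32) ⟩
    square (fromℕ 1) + fromℕ 32   ≈⟨ ≃-pointwise (λ _ → ≡.refl) ⟩
    fromℕ 33                ≈⟨ s-square ⟨
    square s                ∎)

  0≤κ : fromℕ 0 ≤ κ
  0≤κ = *-nonNeg (≤-trans (≤-pointwise λ _ → ℚ.≤-refl) (+-mono-≤ 1≤s (≤-refl { - fromℕ 1}))) 0≤¼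

  0≤ρ : fromℕ 0 ≤ ρ
  0≤ρ = *-nonNeg (√-nonNeg _) 0≤¼

  κ-root : fromℕ 2 * square κ + κ ≃ fromℕ 4
  κ-root = begin-equality
    fromℕ 2 * square κ + κ
      ≈⟨ ≃-pointwise (λ n → solve 1 (λ s → let κ = (s :- con 1ℚ) :* con (+ 1 ℚ./ 4) in
           con (+ 2 ℚ./ 1) :* (κ :* κ) :+ κ := con (+ 1 ℚ./ 8) :* (s :* s :- con 1ℚ)) ≡.refl (approx s n)) ⟩
    fromℚ (+ 1 ℚ./ 8) * (square s - fromℕ 1)
      ≈⟨ *-congˡ (+-congʳ s-square) ⟩
    fromℚ (+ 1 ℚ./ 8) * (fromℕ 33 - fromℕ 1)
      ≈⟨ ≃-pointwise (λ _ → ≡.refl) ⟩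
    fromℕ 4 ∎

  ρ-square : square ρ ≃ fromℕ 4 - square κ
  ρ-square = begin-equality
    square ρ
      ≈⟨ ≃-pointwise (λ n → solve 1 (λ r → let ¼ = con (+ 1 ℚ./ 4) in
           (r :* ¼) :* (r :* ¼) := con (+ 1 ℚ./ 16) :* (r :* r)) ≡.refl (approx r n)) ⟩
    fromℚ (+ 1 ℚ./ 16) * square r
      ≈⟨ *-congˡ r-square ⟩
    fromℚ (+ 1 ℚ./ 16) * (fromℕ 30 + fromℕ 2 * s)
      ≈⟨ ≃-pointwise (λ n → solve 1 (λ s → con (+ 1 ℚ./ 16) :* (con (+ 30 ℚ./ 1) :+ con (+ 2 ℚ./ 1) :* s) :=
           con (+ 4 ℚ./ 1) :- con (+ 1 ℚ./ 16) :* (con (+ 33 ℚ./ 1) :+ (con 1ℚ :- con (+ 2 ℚ./ 1) :* s))) ≡.refl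
           (approx s n)) ⟩
    fromℕ 4 - fromℚ (+ 1 ℚ./ 16) * (fromℕ 33 + (fromℕ 1 - fromℕ 2 * s))
      ≈⟨ +-congˡ (-‿cong (*-congˡ (+-congʳ s-square))) ⟨
    fromℕ 4 - fromℚ (+ 1 ℚ./ 16) * (square s + (fromℕ 1 - fromℕ 2 * s))
      ≈⟨ ≃-pointwise (λ n → solve 1 (λ s → let κ = (s :- con 1ℚ) :* con (+ 1 ℚ./ 4) in
           con (+ 4 ℚ./ 1) :- con (+ 1 ℚ./ 16) :* (s :* s :+ (con 1ℚ :- con (+ 2 ℚ./ 1) :* s)) :=
           con (+ 4 ℚ./ 1) :- κ :* κ) ≡.refl (approx s n)) ⟩
    fromℕ 4 - square κ ∎

  optimum≃c₂ : ρ * (fromℕ 1 + κ) ≃ (s + fromℕ 3) / 16 * r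
  optimum≃c₂ = ≃-pointwise λ n → solve 2 (λ s r →
    (r :* con ¼) :* (con 1ℚ :+ (s :- con 1ℚ) :* con ¼) :=
    (s :+ con (+ 3 ℚ./ 1)) :* con (+ 1 ℚ./ 16) :* r) ≡.refl (approx s n) (approx r n)
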